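{- Let $n\ge 2$ and $1\le k\le n-1$. The Laplacian spectrum of the enhanced hypercube $Q_{n,k}$ is \[\mathrm{Spec}_L(Q_{n,k})=\{0,\ [2]^{k-1},\ [2t+2]^{\gamma_t}\ (t=1,\dots,n-1),\ [2n+2]^{\gamma_n}\},\] where $\gamma_t=\sum_{j=0}^{n}{n-k+2\choose 2j}{k-1\choose t+1-2j}$ for $1\le t\le n-1$ and $\gamma_n=\sum_{j=1}^{n}{n-k+1\choose 2j-1}{k-1\choose n-2j+1}$.
   Context: For $n\ge 2$ and $1\le k\le n-1$, the enhanced hypercube $Q_{n,k}$ is the simple graph whose vertices are the binary strings $x_1x_2\cdots x_n$ ($x_i\in\{0,1\}$), where $X=x_1\cdots x_n$ and $Y$ are adjacent iff either $Y$ is obtained from $X$ by complementing exactly one coordinate ($1\le i\le n$), or $Y=x_1\cdots x_{k-1}\overline{x_k}\,\overline{x_{k+1}}\cdots\overline{x_n}$. The Laplacian matrix is $L=D-A$ ($D$ the diagonal degree matrix, $A$ the adjacency matrix); the Laplacian spectrum is the multiset of its eigenvalues, and $[\mu]^m$ denotes eigenvalue $\mu$ with multiplicity $m$ (multiplicity $0$ meaning $\mu$ does not occur). Binomial coefficients ${a\choose b}$ are $0$ when $b<0$ or $b>a$. -}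

module Defs where

open import Data.Bool using (Bool; true; false; not; if_then_else_; _∨_)
open import Data.Nat using (ℕ; zero; suc; _≤ᵇ_; _≡ᵇ_)
import Data.Nat as N
open import Data.Nat.Combinatorics using (_C_)
open import Data.Integer using (ℤ; +_; _+_; _*_; -_; _-_)
open import Data.List using (List; []; _∷_; _++_; map; foldr; concatMap; upTo)
open import Data.Vec using (Vec; tabulate; lookup; zipWith; toList)
import Data.Vec as Vec
open import Data.Vec.Properties using (≡-dec)
import Data.Bool as B
open import Data.Fin using (Fin; toℕ)
open import Relation.Nullary using (does)
open import Data.Product using (_×_; _,_)
open import Relation.Binary.PropositionalEquality using (_≡_)

-- Univariate integer polynomials ℤ[x] as coefficient lists
-- (constant coefficient first).

Poly : Set
Poly = List ℤ

_+ₚ_ : Poly → Poly → Poly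
[] +ₚ q = q
(a ∷ p) +ₚ [] = a ∷ p
(a ∷ p) +ₚ (b ∷ q) = (a + b) ∷ (p +ₚ q)

_·ₚ_ : ℤ → Poly → Poly
c ·ₚ p = map (c *_) p

_*ₚ_ : Poly → Poly → Poly
p *ₚ q = foldr (λ a acc → (a ·ₚ q) +ₚ (+ 0 ∷ acc)) [] p

1ₚ : Poly
1ₚ = + 1 ∷ []

Xₚ : Poly
Xₚ = + 0 ∷ + 1 ∷ []

constₚ : ℤ → Poly
constₚ c = c ∷ []

_^ₚ_ : Poly → ℕ → Poly
p ^ₚ zero = 1ₚ
p ^ₚ suc m = p *ₚ (p ^ₚ m)

coeff : Poly → ℕ → ℤ
coeff [] i = + 0
coeff (a ∷ p) zero = a
coeff (a ∷ p) (suc i) = coeff p i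

-- equality of polynomials (coefficientwise; insensitive to trailing zeros)
_≈ₚ_ : Poly → Poly → Set
p ≈ₚ q = ∀ i → coeff p i ≡ coeff q i
  where open import Relation.Binary.PropositionalEquality using (_≡_)

-- Determinant of a square matrix whose rows and columns are indexed by
-- the elements of a list (Laplace expansion along the first row).

mutual
  det : {V : Set} → List V → List V → (V → V → Poly) → Poly
  det [] cs M = 1ₚ
  det (r ∷ rs) cs M = laplace r rs M [] cs (+ 1)

  -- expansion along row r; 'pre' are the columns already passed,
  -- 's' is the sign (-1)^(position of the current column)
  laplace : {V : Set} → V → List V → (V → V → Poly) → List V → List V → ℤ → Poly
  laplace r rs M pre [] s = []
  laplace r rs M pre (c ∷ post) s =
    ((s ·ₚ M r c) *ₚ det rs (pre ++ post) M)
      +ₚ laplace r rs M (pre ++ (c ∷ [])) post (- s)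

-- Σ_{j=a}^{b} f j  (empty if b < a)
sumFromTo : ℕ → ℕ → (ℕ → ℕ) → ℕ
sumFromTo a b f = foldr (λ i acc → f (a N.+ i) N.+ acc) 0 (upTo (suc b N.∸ a))

Vertex : ℕ → Set
Vertex n = Vec Bool n

allVertices : (n : ℕ) → List (Vertex n)
allVertices zero = Vec.[] ∷ []
allVertices (suc n) = map (true Vec.∷_) (allVertices n) ++ map (false Vec.∷_) (allVertices n)

_≟ᵥ_ : {n : ℕ} → (X Y : Vertex n) → Bool
X ≟ᵥ Y = does (≡-dec B._≟_ X Y)

hamming : {n : ℕ} → Vertex n → Vertex n → ℕ
hamming X Y = foldr N._+_ 0 (toList (zipWith (λ a b → if does (a B.≟ b) then 0 else 1) X Y))

-- x_1 ... x_{k-1} (not x_k) ... (not x_n)   (coordinates are 1-indexed;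
-- coordinate i+1 corresponds to Fin index i)
flipFrom : {n : ℕ} → ℕ → Vertex n → Vertex n
flipFrom k X = tabulate (λ i → if k ≤ᵇ suc (toℕ i) then not (lookup X i) else lookup X i)

adjacent : (n k : ℕ) → Vertex n → Vertex n → Bool
adjacent n k X Y = (hamming X Y ≡ᵇ 1) ∨ (Y ≟ᵥ flipFrom k X)

adjMat : (n k : ℕ) → Vertex n → Vertex n → ℤ
adjMat n k X Y = if adjacent n k X Y then + 1 else + 0

degree : (n k : ℕ) → Vertex n → ℤ
degree n k X = foldr (λ Y acc → adjMat n k X Y + acc) (+ 0) (allVertices n)

laplacian : (n k : ℕ) → Vertex n → Vertex n → ℤ
laplacian n k X Y = (if X ≟ᵥ Y then degree n k X else + 0) - adjMat n k X Y

charPolyL : (n k : ℕ) → Poly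
charPolyL n k = det (allVertices n) (allVertices n)
  (λ X Y → (if X ≟ᵥ Y then Xₚ else []) +ₚ constₚ (- laplacian n k X Y))

-- The claimed spectrum, as a multiset: list of (eigenvalue, multiplicity).

γ : (n k t : ℕ) → ℕ
γ n k t = sumFromTo 0 n (λ j →
  ((n N.∸ k N.+ 2) C (2 N.* j)) N.*
  (if (2 N.* j) ≤ᵇ (t N.+ 1) then ((k N.∸ 1) C (t N.+ 1 N.∸ 2 N.* j)) else 0))

γₙ : (n k : ℕ) → ℕ
γₙ n k = sumFromTo 1 n (λ j →
  ((n N.∸ k N.+ 1) C (2 N.* j N.∸ 1)) N.*
  (if (2 N.* j) ≤ᵇ (n N.+ 1) then ((k N.∸ 1) C (n N.+ 1 N.∸ 2 N.* j)) else 0))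

claimedSpectrum : (n k : ℕ) → List (ℕ × ℕ)
claimedSpectrum n k =
  (0 , 1) ∷ (2 , k N.∸ 1) ∷
  (map (λ i → (2 N.* (suc i) N.+ 2 , γ n k (suc i))) (upTo (n N.∸ 1))
   ++ ((2 N.* n N.+ 2 , γₙ n k) ∷ []))
  where open import Data.Product using (_×_; _,_)

specPoly : List (ℕ × ℕ) → Poly
specPoly = foldr (λ { (μ , m) acc → ((Xₚ +ₚ constₚ (- (+ μ))) ^ₚ m) *ₚ acc }) 1ₚ
  where open import Data.Product using (_×_; _,_)

module Submission where

-- The characters χ_S of (ℤ/2)^n are eigenvectors of the Laplacian: with w the weight
-- of S and o = 1 or 0 according as S has odd or even weight on the coordinates k, …, n,
-- the eigenvalue is 2(w + o).  To read this off the determinant without multiplicativity of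
-- determinants, evaluate at an integer x and regard a determinant as an iterated
-- wedge of its rows.  The Walsh transform of a family of rows is a sequence of butterflies
-- (a, b) ↦ (b - a, b + a), hence multiplies the wedge by a nonzero constant, the
-- same for every family.  Applied to the rows of xI - L it yields the rows
-- (x - 2(w + o)) χ_S, applied to the rows of I it yields the χ_S; comparing, the constant
-- cancels.  It remains to count the S with w + o = t, by Pascal's rule on the first
-- k - 1 coordinates.

open import Defs
import Data.Bool as Bool
import Data.Nat as ℕ
import Data.Nat.Properties as ℕ
open import Algebra.Properties.CommutativeSemigroup ℕ.+-commutativeSemigroup using (interchange)
open import Data.Bool using (Bool; true; false; not; if_then_else_; _xor_)
open import Data.Bool.Properties using (not-involutive; ∨-identityʳ)
open import Data.Empty using (⊥-elim)
open import Data.Integer using (ℤ; +_; _+_; _*_; -_; _-_; _^_; ∣_∣; -1ℤ; 0ℤ; 1ℤ; ≢-nonZero)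
open import Data.Integer.Properties
open import Data.Integer.Tactic.RingSolver using (solve-∀)
open import Data.List using (List; []; _∷_; _++_; map; foldr; length; upTo)
open import Data.List.Membership.Propositional using (_∈_)
open import Data.List.Membership.Propositional.Properties using (∈-map⁻)
open import Data.List.Properties using (++-assoc; foldr-++; length-map; map-++; map-∘; map-upTo; upTo-∷ʳ)
open import Data.List.Relation.Unary.All as All using (All; []; _∷_)
open import Data.List.Relation.Unary.AllPairs using ([]; _∷_)
open import Data.List.Relation.Unary.Unique.Propositional using (Unique)
import Data.List.Relation.Unary.Unique.Propositional.Properties as Unique
open import Data.Nat using (ℕ; zero; suc; _≤_; _<_; _∸_; _≡ᵇ_; _≤ᵇ_; z≤n; s≤s; z<s; s<s)
open import Data.Nat.Combinatorics using (_C_; nCk+nC[k+1]≡[n+1]C[k+1]; k>n⇒nCk≡0)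
open import Data.Product using (∃; _×_; _,_; proj₁; proj₂)
open import Data.Vec using () renaming ([] to []ᵥ; _∷_ to _∷ᵥ_)
open import Data.Sum using ([_,_]′)
open import Data.Vec.Properties using (≡-dec; ∷-injectiveʳ)
open import Function using (_∘_)
open import Relation.Binary.PropositionalEquality
open import Relation.Nullary using (yes; no)
open ≡-Reasoning

-- Evaluation of polynomials

eval : ℤ → Poly → ℤ
eval x []      = + 0
eval x (a ∷ p) = a + x * eval x p

eval-+ : ∀ x p q → eval x (p +ₚ q) ≡ eval x p + eval x q
eval-+ x [] q = sym (+-identityˡ _)
eval-+ x (a ∷ p) [] = sym (+-identityʳ _)
eval-+ x (a ∷ p) (b ∷ q) rewrite eval-+ x p q = lemma a b x (eval x p) (eval x q)
  where
  lemma : ∀ a b x u v → a + b + x * (u + v) ≡ a + x * u + (b + x * v)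
  lemma = solve-∀

eval-· : ∀ x c p → eval x (c ·ₚ p) ≡ c * eval x p
eval-· x c [] = sym (*-zeroʳ c)
eval-· x c (a ∷ p) rewrite eval-· x c p = lemma a c x (eval x p)
  where
  lemma : ∀ a c x u → c * a + x * (c * u) ≡ c * (a + x * u)
  lemma = solve-∀

eval-* : ∀ x p q → eval x (p *ₚ q) ≡ eval x p * eval x q
eval-* x [] q = refl
eval-* x (a ∷ p) q
  rewrite eval-+ x (a ·ₚ q) (+ 0 ∷ (p *ₚ q)) | eval-· x a q | eval-* x p q
  = lemma a x (eval x p) (eval x q)
  where
  lemma : ∀ a x u v → a * v + (+ 0 + x * (u * v)) ≡ (a + x * u) * v
  lemma = solve-∀

eval-1 : ∀ x → eval x 1ₚ ≡ 1ℤ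
eval-1 = lemma
  where
  lemma : ∀ x → 1ℤ + x * 0ℤ ≡ 1ℤ
  lemma = solve-∀

eval-^ : ∀ x p m → eval x (p ^ₚ m) ≡ eval x p ^ m
eval-^ x p zero = eval-1 x
eval-^ x p (suc m) = trans (eval-* x p (p ^ₚ m)) (cong (eval x p *_) (eval-^ x p m))

coeff-+ : ∀ p q i → coeff (p +ₚ q) i ≡ coeff p i + coeff q i
coeff-+ [] q i = sym (+-identityˡ _)
coeff-+ (a ∷ p) [] i = sym (+-identityʳ _)
coeff-+ (a ∷ p) (b ∷ q) zero = refl
coeff-+ (a ∷ p) (b ∷ q) (suc i) = coeff-+ p q i

coeff-· : ∀ c p i → coeff (c ·ₚ p) i ≡ c * coeff p i
coeff-· c [] i = sym (*-zeroʳ c)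
coeff-· c (a ∷ p) zero = refl
coeff-· c (a ∷ p) (suc i) = coeff-· c p i

-- A value at ∣a∣ + 1 forces the constant coefficient a to be a multiple of ∣a∣ + 1.
constant-vanishes : ∀ a (e : ℤ) → a + + suc ∣ a ∣ * e ≡ + 0 → a ≡ + 0
constant-vanishes a e eq = ∣i∣≡0⇒i≡0 (small ∣ a ∣ ∣ e ∣ abs-eq)
  where
  lemma : ∀ a y → a ≡ a + y + - y
  lemma = solve-∀
  abs-eq : ∣ a ∣ ≡ suc ∣ a ∣ ℕ.* ∣ e ∣
  abs-eq = begin
    ∣ a ∣                                                     ≡⟨ cong ∣_∣ (lemma a (+ suc ∣ a ∣ * e)) ⟩
    ∣ a + + suc ∣ a ∣ * e + - (+ suc ∣ a ∣ * e) ∣             ≡⟨ cong (λ z → ∣ z + - (+ suc ∣ a ∣ * e) ∣) eq ⟩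
    ∣ + 0 + - (+ suc ∣ a ∣ * e) ∣                             ≡⟨ cong ∣_∣ (+-identityˡ (- (+ suc ∣ a ∣ * e))) ⟩
    ∣ - (+ suc ∣ a ∣ * e) ∣                                   ≡⟨ ∣-i∣≡∣i∣ (+ suc ∣ a ∣ * e) ⟩
    ∣ + suc ∣ a ∣ * e ∣                                       ≡⟨ abs-* (+ suc ∣ a ∣) e ⟩
    suc ∣ a ∣ ℕ.* ∣ e ∣                                       ∎
  small : ∀ m k → m ≡ suc m ℕ.* k → m ≡ 0
  small m zero h = trans h (ℕ.*-zeroʳ m)
  small m (suc k) h =
    ⊥-elim (ℕ.<-irrefl refl (subst (suc m ℕ.≤_) (sym h) (ℕ.m≤m*n (suc m) (suc k))))

-- Induction on Horner's form. The point `∣ a ∣ + 1`, chosen after `a`, kills the constant term;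
-- what is left is `+ suc m` times the value of the tail, and this positive factor cancels.
eval-zero⇒coeff-zero : ∀ p → (∀ m → eval (+ suc m) p ≡ + 0) → ∀ i → coeff p i ≡ + 0
eval-zero⇒coeff-zero [] h i = refl
eval-zero⇒coeff-zero (a ∷ p) h = λ where
    zero    → a≡0
    (suc i) → eval-zero⇒coeff-zero p tail-vanishes i
  where
  a≡0 : a ≡ + 0
  a≡0 = constant-vanishes a (eval (+ suc ∣ a ∣) p) (h ∣ a ∣)
  tail-vanishes : ∀ m → eval (+ suc m) p ≡ + 0
  tail-vanishes m = [ (λ ()) , (λ e → e) ]′ (i*j≡0⇒i≡0∨j≡0 (+ suc m) (begin
    + suc m * eval (+ suc m) p       ≡⟨ +-identityˡ _ ⟨
    + 0 + + suc m * eval (+ suc m) p ≡⟨ cong (λ z → z + + suc m * eval (+ suc m) p) a≡0 ⟨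
    a + + suc m * eval (+ suc m) p   ≡⟨ h m ⟩
    + 0                              ∎))

-- Reduces the theorem to values at positive integers. The difference is formed as p plus -1 times
-- q, so that `eval` and `coeff` treat it by linearity.
eval-≡⇒≈ₚ : ∀ p q → (∀ m → eval (+ suc m) p ≡ eval (+ suc m) q) → p ≈ₚ q
eval-≡⇒≈ₚ p q h i = i-j≡0⇒i≡j (coeff p i) (coeff q i) (begin
    coeff p i - coeff q i           ≡⟨ cong (λ z → coeff p i + z) (-1*i≡-i (coeff q i)) ⟨
    coeff p i + -1ℤ * coeff q i     ≡⟨ cong (λ z → coeff p i + z) (coeff-· -1ℤ q i) ⟨
    coeff p i + coeff (-1ℤ ·ₚ q) i  ≡⟨ coeff-+ p (-1ℤ ·ₚ q) i ⟨
    coeff (p +ₚ (-1ℤ ·ₚ q)) i       ≡⟨ eval-zero⇒coeff-zero (p +ₚ (-1ℤ ·ₚ q)) difference i ⟩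
    + 0                             ∎)
  where
  difference : ∀ m → eval (+ suc m) (p +ₚ (-1ℤ ·ₚ q)) ≡ + 0
  difference m = begin
    eval (+ suc m) (p +ₚ (-1ℤ ·ₚ q))                ≡⟨ eval-+ (+ suc m) p (-1ℤ ·ₚ q) ⟩
    eval (+ suc m) p + eval (+ suc m) (-1ℤ ·ₚ q)    ≡⟨ cong (λ z → eval (+ suc m) p + z) (eval-· (+ suc m) -1ℤ q) ⟩
    eval (+ suc m) p + -1ℤ * eval (+ suc m) q       ≡⟨ cong (λ z → eval (+ suc m) p + z) (-1*i≡-i (eval (+ suc m) q)) ⟩
    eval (+ suc m) p - eval (+ suc m) q             ≡⟨ i≡j⇒i-j≡0 (h m) ⟩
    + 0                                             ∎

-- Exterior algebra

-- The Laplace expansion along a row r, with D supplying the minors of the remaining rows.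
wedge : {V : Set} → (V → ℤ) → (List V → ℤ) → List V → ℤ
wedge r D []       = + 0
wedge r D (c ∷ cs) = r c * D cs - wedge r (λ xs → D (c ∷ xs)) cs

wedges : {V : Set} → List (V → ℤ) → (List V → ℤ) → List V → ℤ
wedges rs D = foldr wedge D rs

wedge-cong : {V : Set} {r r′ : V → ℤ} {D D′ : List V → ℤ} →
  (∀ c → r c ≡ r′ c) → (∀ cs → D cs ≡ D′ cs) → ∀ cs → wedge r D cs ≡ wedge r′ D′ cs
wedge-cong hr hD []       = refl
wedge-cong hr hD (c ∷ cs) =
  cong₂ _-_ (cong₂ _*_ (hr c) (hD cs)) (wedge-cong hr (λ xs → hD (c ∷ xs)) cs)

wedge-congʳ : {V : Set} (r : V → ℤ) {D D′ : List V → ℤ} →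
  (∀ cs → D cs ≡ D′ cs) → ∀ cs → wedge r D cs ≡ wedge r D′ cs
wedge-congʳ r = wedge-cong (λ _ → refl)

wedges-congʳ : {V : Set} (rs : List (V → ℤ)) {D D′ : List V → ℤ} →
  (∀ cs → D cs ≡ D′ cs) → ∀ cs → wedges rs D cs ≡ wedges rs D′ cs
wedges-congʳ []       h = h
wedges-congʳ (r ∷ rs) h = wedge-congʳ r (wedges-congʳ rs h)

wedges-map-cong : {I V : Set} {f g : I → V → ℤ} → (∀ i c → f i c ≡ g i c) →
  ∀ (L : List I) D cs → wedges (map f L) D cs ≡ wedges (map g L) D cs
wedges-map-cong h []      D cs = refl
wedges-map-cong h (i ∷ L) D cs = wedge-cong (h i) (wedges-map-cong h L D) cs

wedges-++ : {V : Set} (rs ss : List (V → ℤ)) (D : List V → ℤ) (cs : List V) →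
  wedges (rs ++ ss) D cs ≡ wedges rs (wedges ss D) cs
wedges-++ rs ss D cs = cong (λ E → E cs) (foldr-++ wedge D rs ss)

wedge-linearʳ : {V : Set} (r : V → ℤ) (α β : ℤ) (D E : List V → ℤ) → ∀ cs →
  wedge r (λ xs → α * D xs + β * E xs) cs ≡ α * wedge r D cs + β * wedge r E cs
wedge-linearʳ r α β D E [] = lemma α β
  where
  lemma : ∀ α β → + 0 ≡ α * + 0 + β * + 0
  lemma = solve-∀
wedge-linearʳ r α β D E (c ∷ cs)
  rewrite wedge-linearʳ r α β (λ xs → D (c ∷ xs)) (λ xs → E (c ∷ xs)) cs
  = lemma (r c) α β (D cs) (E cs) _ _
  where
  lemma : ∀ r α β d e x y →
    r * (α * d + β * e) - (α * x + β * y) ≡ α * (r * d - x) + β * (r * e - y)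
  lemma = solve-∀

wedge-linearˡ : {V : Set} (u v : V → ℤ) (α β : ℤ) (D : List V → ℤ) → ∀ cs →
  wedge (λ c → α * u c + β * v c) D cs ≡ α * wedge u D cs + β * wedge v D cs
wedge-linearˡ u v α β D [] = lemma α β
  where
  lemma : ∀ α β → + 0 ≡ α * + 0 + β * + 0
  lemma = solve-∀
wedge-linearˡ u v α β D (c ∷ cs)
  rewrite wedge-linearˡ u v α β (λ xs → D (c ∷ xs)) cs
  = lemma (u c) (v c) α β (D cs) _ _
  where
  lemma : ∀ u v α β d x y →
    (α * u + β * v) * d - (α * x + β * y) ≡ α * (u * d - x) + β * (v * d - y)
  lemma = solve-∀

private
  pad : ∀ k x → k * x ≡ k * x + + 0 * x
  pad = solve-∀

wedge-scaleʳ : {V : Set} (r : V → ℤ) (k : ℤ) (D : List V → ℤ) → ∀ cs →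
  wedge r (λ xs → k * D xs) cs ≡ k * wedge r D cs
wedge-scaleʳ r k D cs = begin
  wedge r (λ xs → k * D xs) cs               ≡⟨ wedge-congʳ r (λ xs → pad k (D xs)) cs ⟩
  wedge r (λ xs → k * D xs + + 0 * D xs) cs  ≡⟨ wedge-linearʳ r k (+ 0) D D cs ⟩
  k * wedge r D cs + + 0 * wedge r D cs      ≡⟨ pad k (wedge r D cs) ⟨
  k * wedge r D cs                           ∎

wedge-scaleˡ : {V : Set} (r : V → ℤ) (k : ℤ) (D : List V → ℤ) → ∀ cs →
  wedge (λ c → k * r c) D cs ≡ k * wedge r D cs
wedge-scaleˡ r k D cs = begin
  wedge (λ c → k * r c) D cs                 ≡⟨ wedge-cong (λ c → pad k (r c)) (λ _ → refl) cs ⟩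
  wedge (λ c → k * r c + + 0 * r c) D cs     ≡⟨ wedge-linearˡ r r k (+ 0) D cs ⟩
  k * wedge r D cs + + 0 * wedge r D cs      ≡⟨ pad k (wedge r D cs) ⟨
  k * wedge r D cs                           ∎

wedges-scaleʳ : {V : Set} (rs : List (V → ℤ)) (k : ℤ) (D : List V → ℤ) → ∀ cs →
  wedges rs (λ xs → k * D xs) cs ≡ k * wedges rs D cs
wedges-scaleʳ []       k D cs = refl
wedges-scaleʳ (r ∷ rs) k D cs =
  trans (wedge-congʳ r (wedges-scaleʳ rs k D) cs) (wedge-scaleʳ r k (wedges rs D) cs)

-- Expanding both factors at the first column, `r c * wedge r D cs` arises once from the outer
-- factor and once, with opposite sign, from the inner one. What survives is the same expression on
-- a shorter list, with `c` absorbed into the minor.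
wedge-alternating : {V : Set} (r : V → ℤ) (D : List V → ℤ) → ∀ cs →
  wedge r (wedge r D) cs ≡ + 0
wedge-alternating r D []       = refl
wedge-alternating r D (c ∷ cs) = begin
  r c * wedge r D cs - wedge r (λ xs → r c * D xs - wedge r D′ xs) cs
    ≡⟨ cong (λ z → r c * wedge r D cs - z) (trans
         (wedge-congʳ r (λ xs → minus (r c * D xs) (r c) (D xs) (wedge r D′ xs) refl) cs)
         (wedge-linearʳ r (r c) -1ℤ D (wedge r D′) cs)) ⟩
  r c * wedge r D cs - (r c * wedge r D cs + -1ℤ * wedge r (wedge r D′) cs)
    ≡⟨ cong (λ z → r c * wedge r D cs - (r c * wedge r D cs + -1ℤ * z)) (wedge-alternating r D′ cs) ⟩
  r c * wedge r D cs - (r c * wedge r D cs + -1ℤ * + 0)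
    ≡⟨ cancel (r c * wedge r D cs) ⟩
  + 0 ∎
  where
  D′ = λ xs → D (c ∷ xs)
  minus : ∀ z a d w → z ≡ a * d → z - w ≡ a * d + -1ℤ * w
  minus z a d w refl = cong (λ t → z + t) (sym (-1*i≡-i w))
  cancel : ∀ z → z - (z + -1ℤ * + 0) ≡ + 0
  cancel = solve-∀

-- After bilinear expansion u ∧ u and v ∧ v drop out. The coefficients stay arbitrary to serve both
-- the polarisation in `wedge-swap` and the butterflies.
wedge-+-alternating : {V : Set} (u v : V → ℤ) (D : List V → ℤ) (α β γ δ : ℤ) → ∀ cs →
  wedge (λ c → α * u c + β * v c) (wedge (λ c → γ * u c + δ * v c) D) cs
    ≡ α * δ * wedge u (wedge v D) cs + β * γ * wedge v (wedge u D) cs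
wedge-+-alternating u v D α β γ δ cs = begin
  wedge (λ c → α * u c + β * v c) (wedge (λ c → γ * u c + δ * v c) D) cs
    ≡⟨ wedge-linearˡ u v α β _ cs ⟩
  α * wedge u (wedge (λ c → γ * u c + δ * v c) D) cs + β * wedge v (wedge (λ c → γ * u c + δ * v c) D) cs
    ≡⟨ cong₂ (λ x y → α * x + β * y) (expand u) (expand v) ⟩
  α * (γ * wedge u (wedge u D) cs + δ * wedge u (wedge v D) cs)
    + β * (γ * wedge v (wedge u D) cs + δ * wedge v (wedge v D) cs)
    ≡⟨ cong₂ (λ x y → α * (γ * x + δ * wedge u (wedge v D) cs) + β * (γ * wedge v (wedge u D) cs + δ * y))
         (wedge-alternating u D cs) (wedge-alternating v D cs) ⟩
  α * (γ * + 0 + δ * wedge u (wedge v D) cs) + β * (γ * wedge v (wedge u D) cs + δ * + 0)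
    ≡⟨ lemma α β γ δ _ _ ⟩
  α * δ * wedge u (wedge v D) cs + β * γ * wedge v (wedge u D) cs ∎
  where
  expand : ∀ w → wedge w (wedge (λ c → γ * u c + δ * v c) D) cs
    ≡ γ * wedge w (wedge u D) cs + δ * wedge w (wedge v D) cs
  expand w = trans (wedge-congʳ w (wedge-linearˡ u v γ δ D) cs)
                   (wedge-linearʳ w γ δ (wedge u D) (wedge v D) cs)
  lemma : ∀ α β γ δ x y →
    α * (γ * + 0 + δ * x) + β * (γ * y + δ * + 0) ≡ α * δ * x + β * γ * y
  lemma = solve-∀

-- Polarisation of `wedge-alternating` at u + v.
wedge-swap : {V : Set} (u v : V → ℤ) (D : List V → ℤ) → ∀ cs →
  wedge u (wedge v D) cs ≡ -1ℤ * wedge v (wedge u D) cs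
wedge-swap u v D cs = begin
  x                                  ≡⟨ lemma₁ x y ⟩
  1ℤ * 1ℤ * x + 1ℤ * 1ℤ * y - y      ≡⟨ cong (_- y) (wedge-+-alternating u v D 1ℤ 1ℤ 1ℤ 1ℤ cs) ⟨
  wedge w (wedge w D) cs - y         ≡⟨ cong (_- y) (wedge-alternating w D cs) ⟩
  + 0 - y                            ≡⟨ lemma₂ y ⟩
  -1ℤ * y                            ∎
  where
  x = wedge u (wedge v D) cs
  y = wedge v (wedge u D) cs
  w = λ c → 1ℤ * u c + 1ℤ * v c
  lemma₁ : ∀ x y → x ≡ 1ℤ * 1ℤ * x + 1ℤ * 1ℤ * y - y
  lemma₁ = solve-∀
  lemma₂ : ∀ y → + 0 - y ≡ -1ℤ * y
  lemma₂ = solve-∀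

wedges-swap : {V : Set} (rs : List (V → ℤ)) (u : V → ℤ) (D : List V → ℤ) → ∀ cs →
  wedges rs (wedge u D) cs ≡ -1ℤ ^ length rs * wedge u (wedges rs D) cs
wedges-swap []       u D cs = sym (*-identityˡ _)
wedges-swap (r ∷ rs) u D cs = begin
  wedge r (wedges rs (wedge u D)) cs             ≡⟨ wedge-congʳ r (wedges-swap rs u D) cs ⟩
  wedge r (λ xs → k * wedge u (wedges rs D) xs) cs ≡⟨ wedge-scaleʳ r k _ cs ⟩
  k * wedge r (wedge u (wedges rs D)) cs         ≡⟨ cong (k *_) (wedge-swap r u (wedges rs D) cs) ⟩
  k * (-1ℤ * wedge u (wedge r (wedges rs D)) cs) ≡⟨ lemma k _ ⟩
  -1ℤ * k * wedge u (wedge r (wedges rs D)) cs   ∎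
  where
  k = -1ℤ ^ length rs
  lemma : ∀ k z → k * (-1ℤ * z) ≡ -1ℤ * k * z
  lemma = solve-∀

-- For one pair, (b - a) ∧ (b + a) = b ∧ a - a ∧ b = -2 a ∧ b. All differences come before all sums,
-- so each sum row is first carried back across the remaining differences to its partner, and b is
-- then carried forward across the remaining a's.
butterfly : {I V : Set} (a b : I → V → ℤ) (L : List I) (D : List V → ℤ) → ∀ cs →
  wedges (map (λ i c → 1ℤ * b i c + -1ℤ * a i c) L)
    (wedges (map (λ i c → 1ℤ * b i c + 1ℤ * a i c) L) D) cs
  ≡ (- (+ 2)) ^ length L * wedges (map a L) (wedges (map b L) D) cs
butterfly a b []      D cs = sym (*-identityˡ _)
butterfly {V = V} a b (i ∷ L) D cs = begin
  wedge d (wedges ds (wedge s (wedges ss D))) cs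
    ≡⟨ wedge-congʳ d (wedges-swap ds s _) cs ⟩
  wedge d (λ xs → σ ds * wedge s (wedges ds (wedges ss D)) xs) cs
    ≡⟨ wedge-scaleʳ d (σ ds) _ cs ⟩
  σ ds * wedge d (wedge s (wedges ds (wedges ss D))) cs
    ≡⟨ cong (σ ds *_) (wedge-+-alternating (b i) (a i) _ 1ℤ -1ℤ 1ℤ 1ℤ cs) ⟩
  σ ds * (1ℤ * 1ℤ * wedge (b i) (wedge (a i) E) cs + -1ℤ * 1ℤ * wedge (a i) (wedge (b i) E) cs)
    ≡⟨ cong (λ z → σ ds * (1ℤ * 1ℤ * z + -1ℤ * 1ℤ * wedge (a i) (wedge (b i) E) cs))
         (wedge-swap (b i) (a i) E cs) ⟩
  σ ds * (1ℤ * 1ℤ * (-1ℤ * wedge (a i) (wedge (b i) E) cs) + -1ℤ * 1ℤ * wedge (a i) (wedge (b i) E) cs)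
    ≡⟨ lemma₁ (σ ds) _ ⟩
  - (+ 2) * (σ ds * wedge (a i) (wedge (b i) E) cs)
    -- Both moves cross `length L` rows, so the sign of the first is exactly the one that the second
    -- absorbs.
    ≡⟨ cong (λ z → - (+ 2) * (z * wedge (a i) (wedge (b i) E) cs)) (cong (-1ℤ ^_) (trans (length-map _ L) (sym (length-map a L)))) ⟩
  - (+ 2) * (σ as * wedge (a i) (wedge (b i) E) cs)
    ≡⟨ cong (λ z → - (+ 2) * (σ as * z)) (trans
         (wedge-congʳ (a i) (λ xs → trans (wedge-congʳ (b i) (butterfly a b L D) xs) (wedge-scaleʳ (b i) κ F xs)) cs)
         (wedge-scaleʳ (a i) κ _ cs)) ⟩
  - (+ 2) * (σ as * (κ * wedge (a i) (wedge (b i) F) cs))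
    ≡⟨ lemma₂ (σ as) κ _ ⟩
  - (+ 2) * κ * (σ as * wedge (a i) (wedge (b i) F) cs)
    ≡⟨ cong (- (+ 2) * κ *_) (wedge-scaleʳ (a i) (σ as) _ cs) ⟨
  - (+ 2) * κ * wedge (a i) (λ xs → σ as * wedge (b i) F xs) cs
    ≡⟨ cong (- (+ 2) * κ *_) (wedge-congʳ (a i) (wedges-swap as (b i) _) cs) ⟨
  - (+ 2) * κ * wedge (a i) (wedges as (wedge (b i) (wedges (map b L) D))) cs ∎
  where
  d s : V → ℤ
  d = λ c → 1ℤ * b i c + -1ℤ * a i c
  s = λ c → 1ℤ * b i c + 1ℤ * a i c
  ds ss as : List (V → ℤ)
  ds = map (λ i c → 1ℤ * b i c + -1ℤ * a i c) L
  ss = map (λ i c → 1ℤ * b i c + 1ℤ * a i c) L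
  as = map a L
  E F : List V → ℤ
  E = wedges ds (wedges ss D)
  F = wedges as (wedges (map b L) D)
  κ = (- (+ 2)) ^ length L
  σ : List (V → ℤ) → ℤ
  σ rs = -1ℤ ^ length rs
  lemma₁ : ∀ k z → k * (1ℤ * 1ℤ * (-1ℤ * z) + -1ℤ * 1ℤ * z) ≡ - (+ 2) * (k * z)
  lemma₁ = solve-∀
  lemma₂ : ∀ s k z → - (+ 2) * (s * (k * z)) ≡ - (+ 2) * k * (s * z)
  lemma₂ = solve-∀

-- Determinants as iterated wedges

vol : {V : Set} → List (V → ℤ) → List V → ℤ
vol rs = wedges rs (λ _ → 1ℤ)

mutual
  eval-det : {V : Set} (x : ℤ) (M : V → V → Poly) (rs cs : List V) →
    eval x (det rs cs M) ≡ vol (map (λ r c → eval x (M r c)) rs) cs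
  -- `det` is 1 on an empty list of rows whatever columns are left, which is why `vol` starts from a
  -- constant function.
  eval-det x M []       cs = eval-1 x
  eval-det x M (r ∷ rs) cs = trans (eval-laplace x M r rs [] cs 1ℤ) (*-identityˡ _)

  -- Generalised over both accumulators: the sign `s` factors out, and the passed columns `pre` sit
  -- inside the minor, where the recursion of `wedge` collects them too.
  eval-laplace : {V : Set} (x : ℤ) (M : V → V → Poly) (r : V) (rs pre post : List V) (s : ℤ) →
    eval x (laplace r rs M pre post s)
      ≡ s * wedge (λ c → eval x (M r c)) (λ xs → vol (map (λ r c → eval x (M r c)) rs) (pre ++ xs)) post
  eval-laplace x M r rs pre []         s = sym (*-zeroʳ s)
  eval-laplace x M r rs pre (c ∷ post) s = begin
    eval x (((s ·ₚ M r c) *ₚ det rs (pre ++ post) M) +ₚ laplace r rs M (pre ++ (c ∷ [])) post (- s))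
      ≡⟨ eval-+ x ((s ·ₚ M r c) *ₚ det rs (pre ++ post) M) _ ⟩
    eval x ((s ·ₚ M r c) *ₚ det rs (pre ++ post) M) + eval x (laplace r rs M (pre ++ (c ∷ [])) post (- s))
      ≡⟨ cong₂ _+_
           (trans (eval-* x (s ·ₚ M r c) _) (cong₂ _*_ (eval-· x s (M r c)) (eval-det x M rs (pre ++ post))))
           (trans (eval-laplace x M r rs (pre ++ (c ∷ [])) post (- s))
             (cong (- s *_) (wedge-congʳ ρ (λ xs → cong D (++-assoc pre (c ∷ []) xs)) post))) ⟩
    s * ρ c * D (pre ++ post) + - s * wedge ρ (λ xs → D (pre ++ c ∷ xs)) post
      ≡⟨ lemma s (ρ c) _ _ ⟩
    s * (ρ c * D (pre ++ post) - wedge ρ (λ xs → D (pre ++ c ∷ xs)) post) ∎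
    where
    ρ = λ c → eval x (M r c)
    D = vol (map (λ r c → eval x (M r c)) rs)
    lemma : ∀ s a d w → s * a * d + - s * w ≡ s * (a * d - w)
    lemma = solve-∀

-- The Walsh transform

sgn : Bool → ℤ
sgn false = 1ℤ
sgn true  = -1ℤ

-- The sum over X of (-1)^(S·X) g X, taken coordinate by coordinate. The factor `1ℤ` gives both
-- halves the literal shape of the rows in `butterfly`.
walsh : ∀ {n} → Vertex n → (Vertex n → ℤ) → ℤ
walsh []ᵥ      g = g []ᵥ
walsh (s ∷ᵥ S) g = walsh S (λ X → 1ℤ * g (false ∷ᵥ X) + sgn s * g (true ∷ᵥ X))

walsh-cong : ∀ {n} (S : Vertex n) {g h : Vertex n → ℤ} → (∀ X → g X ≡ h X) → walsh S g ≡ walsh S h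
walsh-cong []ᵥ      e = e []ᵥ
walsh-cong (s ∷ᵥ S) e =
  walsh-cong S (λ X → cong₂ (λ a b → 1ℤ * a + sgn s * b) (e (false ∷ᵥ X)) (e (true ∷ᵥ X)))

walsh-linear : ∀ {n} (S : Vertex n) (α β : ℤ) (g h : Vertex n → ℤ) →
  walsh S (λ X → α * g X + β * h X) ≡ α * walsh S g + β * walsh S h
walsh-linear []ᵥ      α β g h = refl
walsh-linear (s ∷ᵥ S) α β g h = trans
  (walsh-cong S (λ X → lemma (sgn s) α β (g (false ∷ᵥ X)) (h (false ∷ᵥ X)) (g (true ∷ᵥ X)) (h (true ∷ᵥ X))))
  (walsh-linear S α β _ _)
  where
  lemma : ∀ s α β g h g′ h′ →
    1ℤ * (α * g + β * h) + s * (α * g′ + β * h′) ≡ α * (1ℤ * g + s * g′) + β * (1ℤ * h + s * h′)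
  lemma = solve-∀

walsh-scale : ∀ {n} (S : Vertex n) (k : ℤ) (g : Vertex n → ℤ) → walsh S (λ X → k * g X) ≡ k * walsh S g
walsh-scale S k g = begin
  walsh S (λ X → k * g X)              ≡⟨ walsh-cong S (λ X → lemma k (g X)) ⟩
  walsh S (λ X → k * g X + 0ℤ * g X)   ≡⟨ walsh-linear S k 0ℤ g g ⟩
  k * walsh S g + 0ℤ * walsh S g       ≡⟨ lemma k (walsh S g) ⟨
  k * walsh S g                        ∎
  where
  lemma : ∀ k x → k * x ≡ k * x + 0ℤ * x
  lemma = solve-∀

-- The determinant of the Hadamard matrix of order 2^n; only its non-vanishing matters.
hadamardDet : ℕ → ℤ
hadamardDet zero    = 1ℤ
hadamardDet (suc n) = hadamardDet n * hadamardDet n * (- (+ 2)) ^ length (allVertices n)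

hadamardDet≢0 : ∀ n → hadamardDet n ≢ 0ℤ
hadamardDet≢0 (suc n) eq =
  [ (λ e → [ hadamardDet≢0 n , hadamardDet≢0 n ]′ (i*j≡0⇒i≡0∨j≡0 (hadamardDet n) e))
  , (λ e → -2≢0 (i^n≡0⇒i≡0 (- (+ 2)) (length (allVertices n)) e)) ]′
  (i*j≡0⇒i≡0∨j≡0 (hadamardDet n * hadamardDet n) eq)
  where
  -2≢0 : - (+ 2) ≢ 0ℤ
  -2≢0 ()

map-allVertices : ∀ {A : Set} n (f : Vertex (suc n) → A) →
  map f (allVertices (suc n))
    ≡ map (λ X → f (true ∷ᵥ X)) (allVertices n) ++ map (λ X → f (false ∷ᵥ X)) (allVertices n)
map-allVertices n f = trans (map-++ f (map (true ∷ᵥ_) (allVertices n)) _)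
  (cong₂ _++_ (sym (map-∘ (allVertices n))) (sym (map-∘ (allVertices n))))

-- The first coordinate turns the family into its difference and sum halves `P` and `Q`; induction
-- removes the transform of each half in the other coordinates, and `butterfly` undoes the first.
-- `D` is arbitrary because the wedge of the rows of `Q` takes its place when induction is applied
-- to `P`.
wedges-walsh : ∀ {V : Set} n (R : Vertex n → V → ℤ) (D : List V → ℤ) cs →
  wedges (map (λ S Y → walsh S (λ X → R X Y)) (allVertices n)) D cs
    ≡ hadamardDet n * wedges (map R (allVertices n)) D cs
wedges-walsh zero    R D cs = sym (*-identityˡ _)
wedges-walsh (suc n) R D cs = begin
  wedges (map (λ S Y → walsh S (λ X → R X Y)) (allVertices (suc n))) D cs
    ≡⟨ cong (λ rs → wedges rs D cs) (map-allVertices n (λ S Y → walsh S (λ X → R X Y))) ⟩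
  wedges (Ŵ P ++ Ŵ Q) D cs                         ≡⟨ wedges-++ (Ŵ P) (Ŵ Q) D cs ⟩
  wedges (Ŵ P) (wedges (Ŵ Q) D) cs                 ≡⟨ wedges-walsh n P (wedges (Ŵ Q) D) cs ⟩
  h * wedges (map P A) (wedges (Ŵ Q) D) cs         ≡⟨ cong (h *_) (wedges-congʳ (map P A) (wedges-walsh n Q D) cs) ⟩
  h * wedges (map P A) (λ xs → h * wedges (map Q A) D xs) cs ≡⟨ cong (h *_) (wedges-scaleʳ (map P A) h _ cs) ⟩
  h * (h * wedges (map P A) (wedges (map Q A) D) cs) ≡⟨ cong (λ z → h * (h * z)) (butterfly a b A D cs) ⟩
  h * (h * (k * wedges (map a A) (wedges (map b A) D) cs)) ≡⟨ lemma h k _ ⟩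
  h * h * k * wedges (map a A) (wedges (map b A) D) cs ≡⟨ cong (h * h * k *_) (wedges-++ (map a A) (map b A) D cs) ⟨
  h * h * k * wedges (map a A ++ map b A) D cs
    ≡⟨ cong (λ rs → h * h * k * wedges rs D cs) (map-allVertices n R) ⟨
  h * h * k * wedges (map R (allVertices (suc n))) D cs ∎
  where
  A = allVertices n
  a = λ X → R (true ∷ᵥ X)
  b = λ X → R (false ∷ᵥ X)
  P = λ X Y → 1ℤ * b X Y + -1ℤ * a X Y
  Q = λ X Y → 1ℤ * b X Y + 1ℤ * a X Y
  Ŵ = λ T → map (λ S Y → walsh S (λ X → T X Y)) A
  h = hadamardDet n
  k = (- (+ 2)) ^ length A
  lemma : ∀ h k z → h * (h * (k * z)) ≡ h * h * k * z
  lemma = solve-∀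

-- Diagonal factors and the identity matrix

product : {I : Set} → (I → ℤ) → List I → ℤ
product g = foldr (λ i acc → g i * acc) 1ℤ

wedges-scale-rows : {I V : Set} (k : I → ℤ) (R : I → V → ℤ) (L : List I) (D : List V → ℤ) → ∀ cs →
  wedges (map (λ i Y → k i * R i Y) L) D cs ≡ product k L * wedges (map R L) D cs
wedges-scale-rows k R []      D cs = sym (*-identityˡ _)
wedges-scale-rows k R (i ∷ L) D cs = begin
  wedge (λ Y → k i * R i Y) (wedges (map (λ i Y → k i * R i Y) L) D) cs
    ≡⟨ wedge-scaleˡ (R i) (k i) _ cs ⟩
  k i * wedge (R i) (wedges (map (λ i Y → k i * R i Y) L) D) cs
    ≡⟨ cong (k i *_) (wedge-congʳ (R i) (wedges-scale-rows k R L D) cs) ⟩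
  k i * wedge (R i) (λ xs → product k L * wedges (map R L) D xs) cs
    ≡⟨ cong (k i *_) (wedge-scaleʳ (R i) (product k L) _ cs) ⟩
  k i * (product k L * wedge (R i) (wedges (map R L) D) cs)
    ≡⟨ *-assoc (k i) (product k L) _ ⟨
  k i * product k L * wedge (R i) (wedges (map R L) D) cs ∎

bit : Bool → ℕ
bit b = if b then 1 else 0

ι : Bool → ℤ
ι b = + bit b

≟ᵥ-refl : ∀ {n} (X : Vertex n) → (X ≟ᵥ X) ≡ true
≟ᵥ-refl X with ≡-dec Bool._≟_ X X
... | yes _ = refl
... | no ¬e = ⊥-elim (¬e refl)

≢⇒≟ᵥ-false : ∀ {n} {X Y : Vertex n} → X ≢ Y → (X ≟ᵥ Y) ≡ false
≢⇒≟ᵥ-false {X = X} {Y} ne with ≡-dec Bool._≟_ X Y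
... | yes e = ⊥-elim (ne e)
... | no _  = refl

wedge-vanishing : {V : Set} {r : V → ℤ} (D : List V → ℤ) {cs : List V} →
  All (λ c → r c ≡ 0ℤ) cs → wedge r D cs ≡ 0ℤ
wedge-vanishing D []             = refl
wedge-vanishing D {c ∷ cs} (e ∷ es) =
  cong₂ (λ a b → a * D cs - b) e (wedge-vanishing (λ xs → D (c ∷ xs)) es)

-- By uniqueness the first row is 1 at its own column and 0 at all later ones, so a single minor
-- survives, again that of an identity matrix.
vol-identity : ∀ {n} {L : List (Vertex n)} → Unique L → vol (map (λ X Y → ι (X ≟ᵥ Y)) L) L ≡ 1ℤ
vol-identity []                          = refl
vol-identity {L = X ∷ L} (X∉L ∷ unique) = cong₂ _-_
  (cong₂ _*_ (cong ι (≟ᵥ-refl X)) (vol-identity unique))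
  (wedge-vanishing _ (All.map (cong ι ∘ ≢⇒≟ᵥ-false) X∉L))

allVertices-unique : ∀ n → Unique (allVertices n)
allVertices-unique zero    = [] ∷ []
allVertices-unique (suc n) = Unique.++⁺
  (Unique.map⁺ ∷-injectiveʳ (allVertices-unique n))
  (Unique.map⁺ ∷-injectiveʳ (allVertices-unique n))
  λ (p , q) → disjoint (∈-map⁻ (true ∷ᵥ_) p) (∈-map⁻ (false ∷ᵥ_) q)
  where
  disjoint : ∀ {v} → (∃ λ X → X ∈ allVertices n × v ≡ true ∷ᵥ X) →
    (∃ λ X → X ∈ allVertices n × v ≡ false ∷ᵥ X) → _
  disjoint (_ , _ , refl) (_ , _ , ())

-- Characters as eigenvectors

χ : ∀ {n} → Vertex n → Vertex n → ℤ
χ []ᵥ      []ᵥ      = 1ℤ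
χ (s ∷ᵥ S) (y ∷ᵥ Y) = (if y then sgn s else 1ℤ) * χ S Y

walsh-combination : ∀ {n} (S : Vertex n) (α β : ℤ) {f g h : Vertex n → ℤ} →
  (∀ X → f X ≡ α * g X + β * h X) → walsh S f ≡ α * walsh S g + β * walsh S h
walsh-combination S α β {g = g} {h} e = trans (walsh-cong S e) (walsh-linear S α β g h)

private
  leftTerm : ∀ s z → 1ℤ * z + s * 0ℤ ≡ 1ℤ * z
  leftTerm = solve-∀
  rightTerm : ∀ s z → 1ℤ * 0ℤ + s * z ≡ s * z
  rightTerm = solve-∀

walsh-identity : ∀ {n} (S Y : Vertex n) → walsh S (λ X → ι (X ≟ᵥ Y)) ≡ χ S Y
walsh-identity []ᵥ      []ᵥ          = refl
walsh-identity (s ∷ᵥ S) (false ∷ᵥ Y) = begin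
  walsh S (λ X → 1ℤ * ι (X ≟ᵥ Y) + sgn s * 0ℤ)  ≡⟨ walsh-cong S (λ X → leftTerm (sgn s) (ι (X ≟ᵥ Y))) ⟩
  walsh S (λ X → 1ℤ * ι (X ≟ᵥ Y))               ≡⟨ walsh-scale S 1ℤ _ ⟩
  1ℤ * walsh S (λ X → ι (X ≟ᵥ Y))               ≡⟨ cong (1ℤ *_) (walsh-identity S Y) ⟩
  1ℤ * χ S Y                                    ∎
walsh-identity (s ∷ᵥ S) (true ∷ᵥ Y) = begin
  walsh S (λ X → 1ℤ * 0ℤ + sgn s * ι (X ≟ᵥ Y))  ≡⟨ walsh-cong S (λ X → rightTerm (sgn s) (ι (X ≟ᵥ Y))) ⟩
  walsh S (λ X → sgn s * ι (X ≟ᵥ Y))            ≡⟨ walsh-scale S (sgn s) _ ⟩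
  sgn s * walsh S (λ X → ι (X ≟ᵥ Y))            ≡⟨ cong (sgn s *_) (walsh-identity S Y) ⟩
  sgn s * χ S Y                                 ∎

hamming≡ᵇ0 : ∀ {n} (X Y : Vertex n) → (hamming X Y ≡ᵇ 0) ≡ (X ≟ᵥ Y)
hamming≡ᵇ0 []ᵥ          []ᵥ          = refl
hamming≡ᵇ0 (false ∷ᵥ X) (false ∷ᵥ Y) = hamming≡ᵇ0 X Y
hamming≡ᵇ0 (false ∷ᵥ X) (true ∷ᵥ Y)  = refl
hamming≡ᵇ0 (true ∷ᵥ X)  (false ∷ᵥ Y) = refl
hamming≡ᵇ0 (true ∷ᵥ X)  (true ∷ᵥ Y)  = hamming≡ᵇ0 X Y

sgn-sum : ∀ {n} → Vertex n → ℤ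
sgn-sum []ᵥ      = 0ℤ
sgn-sum (s ∷ᵥ S) = sgn s + sgn-sum S

private
  -- Inserts the square of a sign where Y starts with `true` and the character carries a factor
  -- `sgn s`; the rest is then a polynomial identity.
  sgn²-absorb : ∀ s z → z ≡ sgn s * (sgn s * z)
  sgn²-absorb false = solve-∀
  sgn²-absorb true  = solve-∀

-- The differing coordinate is either the first, contributing `sgn s` and leaving equal tails, or a
-- later one, where induction applies. So `sgn-sum S` is the eigenvalue of the plain hypercube.
walsh-hypercube : ∀ {n} (S Y : Vertex n) →
  walsh S (λ X → ι (hamming X Y ≡ᵇ 1)) ≡ sgn-sum S * χ S Y
walsh-hypercube []ᵥ      []ᵥ          = refl
walsh-hypercube (s ∷ᵥ S) (false ∷ᵥ Y) = begin
  walsh S (λ X → 1ℤ * ι (hamming X Y ≡ᵇ 1) + sgn s * ι (hamming X Y ≡ᵇ 0))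
    ≡⟨ walsh-combination S 1ℤ (sgn s) (λ X → cong (λ z → 1ℤ * ι (hamming X Y ≡ᵇ 1) + sgn s * ι z) (hamming≡ᵇ0 X Y)) ⟩
  1ℤ * walsh S (λ X → ι (hamming X Y ≡ᵇ 1)) + sgn s * walsh S (λ X → ι (X ≟ᵥ Y))
    ≡⟨ cong₂ (λ a b → 1ℤ * a + sgn s * b) (walsh-hypercube S Y) (walsh-identity S Y) ⟩
  1ℤ * (sgn-sum S * χ S Y) + sgn s * χ S Y
    ≡⟨ lemma (sgn s) (sgn-sum S) (χ S Y) ⟩
  (sgn s + sgn-sum S) * (1ℤ * χ S Y) ∎
  where
  lemma : ∀ s m c → 1ℤ * (m * c) + s * c ≡ (s + m) * (1ℤ * c)
  lemma = solve-∀
walsh-hypercube (s ∷ᵥ S) (true ∷ᵥ Y) = begin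
  walsh S (λ X → 1ℤ * ι (hamming X Y ≡ᵇ 0) + sgn s * ι (hamming X Y ≡ᵇ 1))
    ≡⟨ walsh-combination S 1ℤ (sgn s) (λ X → cong (λ z → 1ℤ * ι z + sgn s * ι (hamming X Y ≡ᵇ 1)) (hamming≡ᵇ0 X Y)) ⟩
  1ℤ * walsh S (λ X → ι (X ≟ᵥ Y)) + sgn s * walsh S (λ X → ι (hamming X Y ≡ᵇ 1))
    ≡⟨ cong₂ (λ a b → 1ℤ * a + sgn s * b) (walsh-identity S Y) (walsh-hypercube S Y) ⟩
  1ℤ * χ S Y + sgn s * (sgn-sum S * χ S Y)
    ≡⟨ cong (λ z → 1ℤ * z + sgn s * (sgn-sum S * χ S Y)) (sgn²-absorb s (χ S Y)) ⟩
  1ℤ * (sgn s * (sgn s * χ S Y)) + sgn s * (sgn-sum S * χ S Y)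
    ≡⟨ lemma (sgn s) (sgn-sum S) (χ S Y) ⟩
  (sgn s + sgn-sum S) * (sgn s * χ S Y) ∎
  where
  lemma : ∀ s m c → 1ℤ * (s * (s * c)) + s * (m * c) ≡ (s + m) * (s * c)
  lemma = solve-∀

-- The complementing map for k = q + 1: the first q coordinates are kept.
flipAfter : ∀ {n} → ℕ → Vertex n → Vertex n
flipAfter q       []ᵥ      = []ᵥ
flipAfter zero    (x ∷ᵥ X) = not x ∷ᵥ flipAfter zero X
flipAfter (suc q) (x ∷ᵥ X) = x ∷ᵥ flipAfter q X

flipFrom≡flipAfter : ∀ {n} q (X : Vertex n) → flipFrom (suc q) X ≡ flipAfter q X
flipFrom≡flipAfter q       []ᵥ      = refl
flipFrom≡flipAfter zero    (x ∷ᵥ X) = cong (not x ∷ᵥ_) (flipFrom≡flipAfter zero X)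
flipFrom≡flipAfter (suc q) (x ∷ᵥ X) = cong (x ∷ᵥ_) (flipFrom≡flipAfter q X)

oddAfter : ∀ {n} → ℕ → Vertex n → Bool
oddAfter q       []ᵥ      = false
oddAfter zero    (s ∷ᵥ S) = s xor oddAfter zero S
oddAfter (suc q) (s ∷ᵥ S) = oddAfter q S

sgn-xor : ∀ s t → sgn (s xor t) ≡ sgn s * sgn t
sgn-xor false t = sym (*-identityˡ (sgn t))
sgn-xor true false = refl
sgn-xor true true  = refl

-- Complementing the coordinates after the first q is translation by a fixed vector, so it acts on a
-- character by a scalar: each complemented coordinate lying in S gives a factor -1.
walsh-flip : ∀ {n} q (S Y : Vertex n) →
  walsh S (λ X → ι (Y ≟ᵥ flipAfter q X)) ≡ sgn (oddAfter q S) * χ S Y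
walsh-flip q       []ᵥ      []ᵥ          = refl
walsh-flip zero    (s ∷ᵥ S) (false ∷ᵥ Y) = begin
  walsh S (λ X → 1ℤ * 0ℤ + sgn s * ι (Y ≟ᵥ flipAfter 0 X)) ≡⟨ walsh-cong S (λ X → rightTerm (sgn s) _) ⟩
  walsh S (λ X → sgn s * ι (Y ≟ᵥ flipAfter 0 X))           ≡⟨ walsh-scale S (sgn s) _ ⟩
  sgn s * walsh S (λ X → ι (Y ≟ᵥ flipAfter 0 X))           ≡⟨ cong (sgn s *_) (walsh-flip 0 S Y) ⟩
  sgn s * (sgn (oddAfter 0 S) * χ S Y)                     ≡⟨ lemma (sgn s) _ (χ S Y) ⟩
  sgn s * sgn (oddAfter 0 S) * (1ℤ * χ S Y)                ≡⟨ cong (_* (1ℤ * χ S Y)) (sgn-xor s (oddAfter 0 S)) ⟨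
  sgn (s xor oddAfter 0 S) * (1ℤ * χ S Y)                  ∎
  where
  lemma : ∀ s t c → s * (t * c) ≡ s * t * (1ℤ * c)
  lemma = solve-∀
walsh-flip zero    (s ∷ᵥ S) (true ∷ᵥ Y) = begin
  walsh S (λ X → 1ℤ * ι (Y ≟ᵥ flipAfter 0 X) + sgn s * 0ℤ) ≡⟨ walsh-cong S (λ X → leftTerm (sgn s) _) ⟩
  walsh S (λ X → 1ℤ * ι (Y ≟ᵥ flipAfter 0 X))              ≡⟨ walsh-scale S 1ℤ _ ⟩
  1ℤ * walsh S (λ X → ι (Y ≟ᵥ flipAfter 0 X))              ≡⟨ cong (1ℤ *_) (walsh-flip 0 S Y) ⟩
  1ℤ * (sgn (oddAfter 0 S) * χ S Y)                        ≡⟨ cong (λ z → 1ℤ * (sgn (oddAfter 0 S) * z)) (sgn²-absorb s (χ S Y)) ⟩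
  1ℤ * (sgn (oddAfter 0 S) * (sgn s * (sgn s * χ S Y)))    ≡⟨ lemma (sgn s) _ (χ S Y) ⟩
  sgn s * sgn (oddAfter 0 S) * (sgn s * χ S Y)             ≡⟨ cong (_* (sgn s * χ S Y)) (sgn-xor s (oddAfter 0 S)) ⟨
  sgn (s xor oddAfter 0 S) * (sgn s * χ S Y)               ∎
  where
  lemma : ∀ s t c → 1ℤ * (t * (s * (s * c))) ≡ s * t * (s * c)
  lemma = solve-∀
walsh-flip (suc q) (s ∷ᵥ S) (false ∷ᵥ Y) = begin
  walsh S (λ X → 1ℤ * ι (Y ≟ᵥ flipAfter q X) + sgn s * 0ℤ) ≡⟨ walsh-cong S (λ X → leftTerm (sgn s) _) ⟩
  walsh S (λ X → 1ℤ * ι (Y ≟ᵥ flipAfter q X))              ≡⟨ walsh-scale S 1ℤ _ ⟩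
  1ℤ * walsh S (λ X → ι (Y ≟ᵥ flipAfter q X))              ≡⟨ cong (1ℤ *_) (walsh-flip q S Y) ⟩
  1ℤ * (sgn (oddAfter q S) * χ S Y)                        ≡⟨ lemma 1ℤ (sgn (oddAfter q S)) (χ S Y) ⟩
  sgn (oddAfter q S) * (1ℤ * χ S Y)                        ∎
  where
  lemma : ∀ s t c → s * (t * c) ≡ t * (s * c)
  lemma = solve-∀
walsh-flip (suc q) (s ∷ᵥ S) (true ∷ᵥ Y) = begin
  walsh S (λ X → 1ℤ * 0ℤ + sgn s * ι (Y ≟ᵥ flipAfter q X)) ≡⟨ walsh-cong S (λ X → rightTerm (sgn s) _) ⟩
  walsh S (λ X → sgn s * ι (Y ≟ᵥ flipAfter q X))           ≡⟨ walsh-scale S (sgn s) _ ⟩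
  sgn s * walsh S (λ X → ι (Y ≟ᵥ flipAfter q X))           ≡⟨ cong (sgn s *_) (walsh-flip q S Y) ⟩
  sgn s * (sgn (oddAfter q S) * χ S Y)                     ≡⟨ lemma (sgn s) (sgn (oddAfter q S)) (χ S Y) ⟩
  sgn (oddAfter q S) * (sgn s * χ S Y)                     ∎
  where
  lemma : ∀ s t c → s * (t * c) ≡ t * (s * c)
  lemma = solve-∀

-- Adjacency and degrees

sumℕ : {I : Set} → (I → ℕ) → List I → ℕ
sumℕ f = foldr (λ i acc → f i ℕ.+ acc) 0

sumℕ-cong : {I : Set} {f g : I → ℕ} → (∀ i → f i ≡ g i) → ∀ L → sumℕ f L ≡ sumℕ g L
sumℕ-cong e []      = refl
sumℕ-cong e (i ∷ L) = cong₂ ℕ._+_ (e i) (sumℕ-cong e L)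

sumℕ-+ : {I : Set} (f g : I → ℕ) → ∀ L → sumℕ (λ i → f i ℕ.+ g i) L ≡ sumℕ f L ℕ.+ sumℕ g L
sumℕ-+ f g []      = refl
sumℕ-+ f g (i ∷ L) = trans (cong (λ z → f i ℕ.+ g i ℕ.+ z) (sumℕ-+ f g L))
  (interchange (f i) (g i) (sumℕ f L) (sumℕ g L))

sumℕ-zero : {I : Set} (L : List I) → sumℕ (λ _ → 0) L ≡ 0
sumℕ-zero []      = refl
sumℕ-zero (i ∷ L) = sumℕ-zero L

sumℕ-++ : {I : Set} (f : I → ℕ) (L M : List I) → sumℕ f (L ++ M) ≡ sumℕ f L ℕ.+ sumℕ f M
sumℕ-++ f []      M = refl
sumℕ-++ f (i ∷ L) M = trans (cong (f i ℕ.+_) (sumℕ-++ f L M)) (sym (ℕ.+-assoc (f i) _ _))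

sumℕ-map : {I J : Set} (f : J → ℕ) (h : I → J) (L : List I) → sumℕ f (map h L) ≡ sumℕ (f ∘ h) L
sumℕ-map f h []      = refl
sumℕ-map f h (i ∷ L) = cong (f (h i) ℕ.+_) (sumℕ-map f h L)

sumℕ-allVertices : ∀ n (f : Vertex (suc n) → ℕ) → sumℕ f (allVertices (suc n))
  ≡ sumℕ (λ X → f (true ∷ᵥ X)) (allVertices n) ℕ.+ sumℕ (λ X → f (false ∷ᵥ X)) (allVertices n)
sumℕ-allVertices n f = trans (sumℕ-++ f (map (true ∷ᵥ_) (allVertices n)) _)
  (cong₂ ℕ._+_ (sumℕ-map f (true ∷ᵥ_) (allVertices n)) (sumℕ-map f (false ∷ᵥ_) (allVertices n)))

count-equal : ∀ {n} (X : Vertex n) → sumℕ (λ Y → bit (Y ≟ᵥ X)) (allVertices n) ≡ 1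
count-equal []ᵥ = refl
count-equal {suc n} (true ∷ᵥ X) = trans (sumℕ-allVertices n (λ Y → bit (Y ≟ᵥ (true ∷ᵥ X))))
  (cong₂ ℕ._+_ (count-equal X) (sumℕ-zero (allVertices n)))
count-equal {suc n} (false ∷ᵥ X) = trans (sumℕ-allVertices n (λ Y → bit (Y ≟ᵥ (false ∷ᵥ X))))
  (cong₂ ℕ._+_ (sumℕ-zero (allVertices n)) (count-equal X))

hamming-sym : ∀ {n} (X Y : Vertex n) → hamming X Y ≡ hamming Y X
hamming-sym []ᵥ          []ᵥ          = refl
hamming-sym (false ∷ᵥ X) (false ∷ᵥ Y) = hamming-sym X Y
hamming-sym (false ∷ᵥ X) (true ∷ᵥ Y)  = cong suc (hamming-sym X Y)
hamming-sym (true ∷ᵥ X)  (false ∷ᵥ Y) = cong suc (hamming-sym X Y)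
hamming-sym (true ∷ᵥ X)  (true ∷ᵥ Y)  = hamming-sym X Y

count-distance-0 : ∀ {n} (X : Vertex n) → sumℕ (λ Y → bit (hamming X Y ≡ᵇ 0)) (allVertices n) ≡ 1
count-distance-0 {n} X = trans
  (sumℕ-cong (λ Y → cong bit (trans (cong (_≡ᵇ 0) (hamming-sym X Y)) (hamming≡ᵇ0 Y X))) (allVertices n))
  (count-equal X)

count-distance-1 : ∀ {n} (X : Vertex n) → sumℕ (λ Y → bit (hamming X Y ≡ᵇ 1)) (allVertices n) ≡ n
count-distance-1 []ᵥ = refl
count-distance-1 {suc n} (true ∷ᵥ X) = trans (sumℕ-allVertices n (λ Y → bit (hamming (true ∷ᵥ X) Y ≡ᵇ 1)))
  (trans (cong₂ ℕ._+_ (count-distance-1 X) (count-distance-0 X)) (ℕ.+-comm n 1))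
count-distance-1 {suc n} (false ∷ᵥ X) = trans (sumℕ-allVertices n (λ Y → bit (hamming (false ∷ᵥ X) Y ≡ᵇ 1)))
  (cong₂ ℕ._+_ (count-distance-0 X) (count-distance-1 X))

hamming-flipAfter : ∀ q m (X : Vertex (q ℕ.+ m)) → hamming X (flipAfter q X) ≡ m
hamming-flipAfter zero    zero    []ᵥ          = refl
hamming-flipAfter zero    (suc m) (false ∷ᵥ X) = cong suc (hamming-flipAfter zero m X)
hamming-flipAfter zero    (suc m) (true ∷ᵥ X)  = cong suc (hamming-flipAfter zero m X)
hamming-flipAfter (suc q) m       (false ∷ᵥ X) = hamming-flipAfter q m X
hamming-flipAfter (suc q) m       (true ∷ᵥ X)  = hamming-flipAfter q m X

-- Since k ≤ n - 1, complementing the last n - k + 1 coordinates is never a hypercube edge.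
adjacent-split : ∀ q m (X Y : Vertex (q ℕ.+ suc (suc m))) →
  bit (adjacent _ (suc q) X Y) ≡ bit (hamming X Y ≡ᵇ 1) ℕ.+ bit (Y ≟ᵥ flipAfter q X)
adjacent-split q m X Y rewrite flipFrom≡flipAfter q X with ≡-dec Bool._≟_ Y (flipAfter q X)
... | yes refl rewrite hamming-flipAfter q (suc (suc m)) X = refl
... | no _ = trans (cong bit (∨-identityʳ (hamming X Y ≡ᵇ 1))) (sym (ℕ.+-identityʳ _))

adjMat≡ι : ∀ n k (X Y : Vertex n) → adjMat n k X Y ≡ ι (adjacent n k X Y)
adjMat≡ι n k X Y with adjacent n k X Y
... | true  = refl
... | false = refl

adjMat-split : ∀ q m (X Y : Vertex (q ℕ.+ suc (suc m))) →
  adjMat _ (suc q) X Y ≡ ι (hamming X Y ≡ᵇ 1) + ι (Y ≟ᵥ flipAfter q X)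
adjMat-split q m X Y = trans (adjMat≡ι _ (suc q) X Y) (cong +_ (adjacent-split q m X Y))

degree-count : ∀ n k (X : Vertex n) →
  degree n k X ≡ + sumℕ (λ Y → bit (adjacent n k X Y)) (allVertices n)
degree-count n k X = go (allVertices n)
  where
  go : ∀ L → foldr (λ Y acc → adjMat n k X Y + acc) 0ℤ L ≡ + sumℕ (λ Y → bit (adjacent n k X Y)) L
  go []      = refl
  go (Y ∷ L) = cong₂ _+_ (adjMat≡ι n k X Y) (go L)

-- There are n neighbours at distance one, and complementing adds one more. Regularity makes the
-- degree matrix a multiple of the identity, so it acts on the characters by a scalar.
degree-regular : ∀ q m (X : Vertex (q ℕ.+ suc (suc m))) →
  degree _ (suc q) X ≡ + (q ℕ.+ suc (suc m)) + 1ℤ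
degree-regular q m X = trans (degree-count n (suc q) X) (cong +_ (begin
  sumℕ (λ Y → bit (adjacent n (suc q) X Y)) (allVertices n)
    ≡⟨ sumℕ-cong (adjacent-split q m X) (allVertices n) ⟩
  sumℕ (λ Y → bit (hamming X Y ≡ᵇ 1) ℕ.+ bit (Y ≟ᵥ flipAfter q X)) (allVertices n)
    ≡⟨ sumℕ-+ (λ Y → bit (hamming X Y ≡ᵇ 1)) (λ Y → bit (Y ≟ᵥ flipAfter q X)) (allVertices n) ⟩
  sumℕ (λ Y → bit (hamming X Y ≡ᵇ 1)) (allVertices n) ℕ.+ sumℕ (λ Y → bit (Y ≟ᵥ flipAfter q X)) (allVertices n)
    ≡⟨ cong₂ ℕ._+_ (count-distance-1 X) (count-equal (flipAfter q X)) ⟩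
  n ℕ.+ 1 ∎))
  where n = q ℕ.+ suc (suc m)

-- The characteristic polynomial at an integer

charEntry : ∀ n k → Vertex n → Vertex n → Poly
charEntry n k X Y = (if X ≟ᵥ Y then Xₚ else []) +ₚ constₚ (- laplacian n k X Y)

-- Splits xI - L into the identity, the hypercube edges and the complementing edges, three matrices
-- whose Walsh transforms are known.
eval-charEntry : ∀ x q m (X Y : Vertex (q ℕ.+ suc (suc m))) →
  eval x (charEntry _ (suc q) X Y)
    ≡ (x - (+ (q ℕ.+ suc (suc m)) + 1ℤ)) * ι (X ≟ᵥ Y)
      + 1ℤ * (1ℤ * ι (hamming X Y ≡ᵇ 1) + 1ℤ * ι (Y ≟ᵥ flipAfter q X))
eval-charEntry x q m X Y
  rewrite adjMat-split q m X Y | degree-regular q m X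
  with X ≟ᵥ Y
... | true  = diagonal x (+ (q ℕ.+ suc (suc m)) + 1ℤ) (ι (hamming X Y ≡ᵇ 1)) (ι (Y ≟ᵥ flipAfter q X))
  where
  diagonal : ∀ x d a b → (0ℤ + - (d - (a + b))) + x * (1ℤ + x * 0ℤ) ≡ (x - d) * 1ℤ + 1ℤ * (1ℤ * a + 1ℤ * b)
  diagonal = solve-∀
... | false = offDiagonal x (+ (q ℕ.+ suc (suc m)) + 1ℤ) (ι (hamming X Y ≡ᵇ 1)) (ι (Y ≟ᵥ flipAfter q X))
  where
  offDiagonal : ∀ x d a b → - (0ℤ - (a + b)) + x * 0ℤ ≡ (x - d) * 0ℤ + 1ℤ * (1ℤ * a + 1ℤ * b)
  offDiagonal = solve-∀

weight : ∀ {n} → Vertex n → ℕ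
weight []ᵥ          = 0
weight (true ∷ᵥ S)  = suc (weight S)
weight (false ∷ᵥ S) = weight S

-- Half the Laplacian eigenvalue carried by the character χ S.
halfEigenvalue : ∀ {n} → ℕ → Vertex n → ℕ
halfEigenvalue q S = weight S ℕ.+ bit (oddAfter q S)

sgn-sum-weight : ∀ {n} (S : Vertex n) → sgn-sum S ≡ + n - + 2 * + weight S
sgn-sum-weight []ᵥ = refl
sgn-sum-weight {suc n} (false ∷ᵥ S) = trans (cong (λ z → 1ℤ + z) (sgn-sum-weight S))
  (sym (+-assoc 1ℤ (+ n) (- (+ 2 * + weight S))))
sgn-sum-weight {suc n} (true ∷ᵥ S) = trans (cong (λ z → -1ℤ + z) (sgn-sum-weight S))
  (lemma (+ n) (+ weight S))
  where
  lemma : ∀ n w → -1ℤ + (n - + 2 * w) ≡ 1ℤ + n - + 2 * (1ℤ + w)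
  lemma = solve-∀

sgn-bit : ∀ b → sgn b ≡ 1ℤ - + 2 * + bit b
sgn-bit false = refl
sgn-bit true  = refl

-- The scalars add up to x - (n + 1) + (n - 2w) + (1 - 2o) = x - 2(w + o).
walsh-charEntry : ∀ x q m (S Y : Vertex (q ℕ.+ suc (suc m))) →
  walsh S (λ X → eval x (charEntry _ (suc q) X Y)) ≡ (x - + (2 ℕ.* halfEigenvalue q S)) * χ S Y
walsh-charEntry x q m S Y = begin
  walsh S (λ X → eval x (charEntry _ (suc q) X Y))
    ≡⟨ walsh-combination S (x - (+ n + 1ℤ)) 1ℤ (λ X → eval-charEntry x q m X Y) ⟩
  (x - (+ n + 1ℤ)) * walsh S (λ X → ι (X ≟ᵥ Y))
    + 1ℤ * walsh S (λ X → 1ℤ * ι (hamming X Y ≡ᵇ 1) + 1ℤ * ι (Y ≟ᵥ flipAfter q X))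
    ≡⟨ cong₂ (λ a b → (x - (+ n + 1ℤ)) * a + 1ℤ * b) (walsh-identity S Y)
         (trans (walsh-linear S 1ℤ 1ℤ (λ X → ι (hamming X Y ≡ᵇ 1)) (λ X → ι (Y ≟ᵥ flipAfter q X)))
           (cong₂ (λ a b → 1ℤ * a + 1ℤ * b) (walsh-hypercube S Y) (walsh-flip q S Y))) ⟩
  (x - (+ n + 1ℤ)) * χ S Y + 1ℤ * (1ℤ * (sgn-sum S * χ S Y) + 1ℤ * (sgn odd * χ S Y))
    ≡⟨ cong₂ (λ a b → (x - (+ n + 1ℤ)) * χ S Y + 1ℤ * (1ℤ * (a * χ S Y) + 1ℤ * (b * χ S Y)))
         (sgn-sum-weight S) (sgn-bit odd) ⟩
  (x - (+ n + 1ℤ)) * χ S Y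
    + 1ℤ * (1ℤ * ((+ n - + 2 * + weight S) * χ S Y) + 1ℤ * ((1ℤ - + 2 * + bit odd) * χ S Y))
    ≡⟨ lemma x (+ n) (+ weight S) (+ bit odd) (χ S Y) ⟩
  (x - + 2 * (+ weight S + + bit odd)) * χ S Y
    ≡⟨ cong (λ z → (x - z) * χ S Y) (sym (pos-* 2 (halfEigenvalue q S))) ⟩
  (x - + (2 ℕ.* halfEigenvalue q S)) * χ S Y ∎
  where
  n = q ℕ.+ suc (suc m)
  odd = oddAfter q S
  lemma : ∀ x n w b c → (x - (n + 1ℤ)) * c + 1ℤ * (1ℤ * ((n - + 2 * w) * c) + 1ℤ * ((1ℤ - + 2 * b) * c))
    ≡ (x - + 2 * (w + b)) * c
  lemma = solve-∀

eval-charPolyL : ∀ x q m → let n = q ℕ.+ suc (suc m) in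
  eval x (charPolyL n (suc q))
    ≡ product (λ S → x - + (2 ℕ.* halfEigenvalue q S)) (allVertices n)
eval-charPolyL x q m = trans (eval-det x (charEntry n (suc q)) A A)
  -- Both sides are multiplied by the nonzero `h`, so that the transformed rows can be compared.
  (*-cancelˡ-≡ h _ _ ⦃ ≢-nonZero (hadamardDet≢0 n) ⦄ (begin
    h * vol (map R A) A
      ≡⟨ wedges-walsh n R _ A ⟨
    vol (map (λ S Y → walsh S (λ X → R X Y)) A) A
      ≡⟨ wedges-map-cong (walsh-charEntry x q m) A _ A ⟩
    vol (map (λ S Y → (x - + (2 ℕ.* halfEigenvalue q S)) * χ S Y) A) A
      ≡⟨ wedges-scale-rows (λ S → x - + (2 ℕ.* halfEigenvalue q S)) χ A _ A ⟩
    p * vol (map χ A) A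
      -- The characters are read backwards as the transform of the rows of the identity, which
      -- brings in the same `h` and a volume known to be 1.
      ≡⟨ cong (p *_) (wedges-map-cong walsh-identity A _ A) ⟨
    p * vol (map (λ S Y → walsh S (λ X → ι (X ≟ᵥ Y))) A) A
      ≡⟨ cong (p *_) (wedges-walsh n (λ X Y → ι (X ≟ᵥ Y)) _ A) ⟩
    p * (h * vol (map (λ X Y → ι (X ≟ᵥ Y)) A) A)
      ≡⟨ cong (λ z → p * (h * z)) (vol-identity (allVertices-unique n)) ⟩
    p * (h * 1ℤ)
      ≡⟨ lemma p h ⟩
    h * p ∎))
  where
  n = q ℕ.+ suc (suc m)
  A = allVertices n
  h = hadamardDet n
  R = λ X Y → eval x (charEntry n (suc q) X Y)
  p = product (λ S → x - + (2 ℕ.* halfEigenvalue q S)) A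
  lemma : ∀ p h → p * (h * 1ℤ) ≡ h * p
  lemma = solve-∀

-- Multiplicities

odd : ℕ → Bool
odd zero    = false
odd (suc t) = not (odd t)

oddAfter-weight : ∀ {n} (S : Vertex n) → oddAfter 0 S ≡ odd (weight S)
oddAfter-weight []ᵥ          = refl
oddAfter-weight (true ∷ᵥ S)  = cong not (oddAfter-weight S)
oddAfter-weight (false ∷ᵥ S) = oddAfter-weight S

multiplicity : ℕ → ℕ → ℕ → ℕ
multiplicity n q t = sumℕ (λ S → bit (halfEigenvalue q S ≡ᵇ t)) (allVertices n)

count-weight : ∀ n t → sumℕ (λ S → bit (weight S ≡ᵇ t)) (allVertices n) ≡ n C t
count-weight zero    zero    = refl
count-weight zero    (suc t) = refl
count-weight (suc n) zero    = trans (sumℕ-allVertices n (λ S → bit (weight S ≡ᵇ 0)))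
  (cong₂ ℕ._+_ (sumℕ-zero (allVertices n)) (count-weight n zero))
count-weight (suc n) (suc t) = trans (sumℕ-allVertices n (λ S → bit (weight S ≡ᵇ suc t)))
  (trans (cong₂ ℕ._+_ (count-weight n t) (count-weight n (suc t))) (nCk+nC[k+1]≡[n+1]C[k+1] n t))

-- For q = 0, the half eigenvalue w + o is w rounded up to an even number.
roundUp : ℕ → ℕ
roundUp w = w ℕ.+ bit (odd w)

roundUp-fibre-0 : ∀ w → (roundUp w ≡ᵇ 0) ≡ (w ≡ᵇ 0)
roundUp-fibre-0 zero    = refl
roundUp-fibre-0 (suc w) = refl

-- An even value t + 1 is reached from t and t + 1, an odd one from nowhere; `odd t` says that t + 1
-- is even. The recursion lowers both arguments by 2, which keeps parities.
roundUp-fibre-suc : ∀ w t → bit (roundUp w ≡ᵇ suc t)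
  ≡ (if odd t then bit (w ≡ᵇ t) ℕ.+ bit (w ≡ᵇ suc t) else 0)
roundUp-fibre-suc zero          zero    = refl
roundUp-fibre-suc zero          (suc t) with not (odd t)
... | true  = refl
... | false = refl
roundUp-fibre-suc (suc zero)    zero          = refl
roundUp-fibre-suc (suc zero)    (suc zero)    = refl
roundUp-fibre-suc (suc zero)    (suc (suc t)) with not (not (odd t))
... | true  = refl
... | false = refl
roundUp-fibre-suc (suc (suc w)) zero          = refl
roundUp-fibre-suc (suc (suc w)) (suc zero)
  rewrite not-involutive (odd w) = cong bit (roundUp-fibre-0 w)
roundUp-fibre-suc (suc (suc w)) (suc (suc t))
  rewrite not-involutive (odd w) | not-involutive (odd t) = roundUp-fibre-suc w t

evenBinomial : ℕ → ℕ → ℕ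
evenBinomial p t = if odd t then 0 else p C t

-- When every coordinate is complemented, an even t + 1 collects the weights t and t + 1, whose
-- counts add up by Pascal's rule. This is the source of the upper index n - k + 2 in γ.
multiplicity-base : ∀ m t → multiplicity m 0 t ≡ evenBinomial (suc m) t
multiplicity-base m t = trans
  (sumℕ-cong (λ S → cong (λ b → bit (weight S ℕ.+ bit b ≡ᵇ t)) (oddAfter-weight S)) (allVertices m))
  (roundedCount t)
  where
  roundedCount : ∀ t → sumℕ (λ S → bit (roundUp (weight S) ≡ᵇ t)) (allVertices m) ≡ evenBinomial (suc m) t
  roundedCount zero = trans
    (sumℕ-cong (λ S → cong bit (roundUp-fibre-0 (weight S))) (allVertices m)) (count-weight m 0)
  roundedCount (suc t) = trans
    (sumℕ-cong (λ S → roundUp-fibre-suc (weight S) t) (allVertices m)) (byParity (odd t))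
    where
    -- Abstracting `odd t` to a Boolean decides the conditionals on both sides at once.
    byParity : ∀ b →
      sumℕ (λ S → if b then bit (weight S ≡ᵇ t) ℕ.+ bit (weight S ≡ᵇ suc t) else 0) (allVertices m)
        ≡ (if not b then 0 else suc m C suc t)
    byParity false = sumℕ-zero (allVertices m)
    byParity true  = trans
      (sumℕ-+ (λ S → bit (weight S ≡ᵇ t)) (λ S → bit (weight S ≡ᵇ suc t)) (allVertices m))
      (trans (cong₂ ℕ._+_ (count-weight m t) (count-weight m (suc t))) (nCk+nC[k+1]≡[n+1]C[k+1] m t))

-- Convolutions of binomial coefficients

shiftedBinomial : ℕ → ℕ → ℕ → ℕ
-- For a > t, truncated subtraction alone would give `q C 0`, which is 1; the guard makes it 0.
shiftedBinomial q t a = if a ≤ᵇ t then q C (t ∸ a) else 0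

shiftedBinomial-suc : ∀ q t a → shiftedBinomial q (suc t) (suc a) ≡ shiftedBinomial q t a
shiftedBinomial-suc q t zero    = refl
shiftedBinomial-suc q t (suc a) = refl

shiftedBinomial-pascal : ∀ q t a →
  shiftedBinomial (suc q) (suc t) a ≡ shiftedBinomial q t a ℕ.+ shiftedBinomial q (suc t) a
shiftedBinomial-pascal q t       zero          = sym (nCk+nC[k+1]≡[n+1]C[k+1] q t)
shiftedBinomial-pascal q zero    (suc zero)    = refl
shiftedBinomial-pascal q zero    (suc (suc a)) = refl
shiftedBinomial-pascal q (suc t) (suc a)
  rewrite shiftedBinomial-suc (suc q) (suc t) a | shiftedBinomial-suc q t a | shiftedBinomial-suc q (suc t) a
  = shiftedBinomial-pascal q t a

shiftedBinomial-0ˡ : ∀ t a → shiftedBinomial 0 t a ≡ bit (t ≡ᵇ a)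
shiftedBinomial-0ˡ zero    zero    = refl
shiftedBinomial-0ˡ (suc t) zero    = refl
shiftedBinomial-0ˡ zero    (suc a) = refl
shiftedBinomial-0ˡ (suc t) (suc a) = trans (shiftedBinomial-suc 0 t a) (shiftedBinomial-0ˡ t a)

shiftedBinomial-0ᵐ : ∀ q a → shiftedBinomial (suc q) 0 a ≡ shiftedBinomial q 0 a
shiftedBinomial-0ᵐ q zero    = refl
shiftedBinomial-0ᵐ q (suc a) = refl

-- The number J of terms is independent of q and t, so that Pascal's rule applies term by term.
-- Terms with 2j > t are 0, so every J with 2J > t gives the full sum.
evenConvolution : ℕ → ℕ → ℕ → ℕ → ℕ
evenConvolution J p q t = sumℕ (λ j → (p C (2 ℕ.* j)) ℕ.* shiftedBinomial q t (2 ℕ.* j)) (upTo J)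

sumℕ-upTo-suc : ∀ (f : ℕ → ℕ) J → sumℕ f (upTo (suc J)) ≡ f 0 ℕ.+ sumℕ (f ∘ suc) (upTo J)
sumℕ-upTo-suc f J = cong (f 0 ℕ.+_)
  (trans (cong (sumℕ f) (sym (map-upTo suc J))) (sumℕ-map f suc (upTo J)))

-- Only j = t/2 can contribute, and the bound puts it in range. Removing the term j = 0 lowers t by
-- 2 and shifts f by 2.
sum-at-double : ∀ J t (f : ℕ → ℕ) → t < 2 ℕ.* J →
  sumℕ (λ j → f (2 ℕ.* j) ℕ.* bit (t ≡ᵇ 2 ℕ.* j)) (upTo J) ≡ (if odd t then 0 else f t)
sum-at-double (suc J) zero f _ = begin
  sumℕ (λ j → f (2 ℕ.* j) ℕ.* bit (0 ≡ᵇ 2 ℕ.* j)) (upTo (suc J))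
    ≡⟨ sumℕ-upTo-suc (λ j → f (2 ℕ.* j) ℕ.* bit (0 ≡ᵇ 2 ℕ.* j)) J ⟩
  f 0 ℕ.* 1 ℕ.+ sumℕ (λ j → f (2 ℕ.* suc j) ℕ.* 0) (upTo J)
    ≡⟨ cong₂ ℕ._+_ (ℕ.*-identityʳ (f 0))
         (trans (sumℕ-cong (λ j → ℕ.*-zeroʳ (f (2 ℕ.* suc j))) (upTo J)) (sumℕ-zero (upTo J))) ⟩
  f 0 ℕ.+ 0
    ≡⟨ ℕ.+-identityʳ (f 0) ⟩
  f 0 ∎
sum-at-double J (suc zero) f _ = trans (sumℕ-cong noDouble (upTo J)) (sumℕ-zero (upTo J))
  where
  noDouble : ∀ j → f (2 ℕ.* j) ℕ.* bit (1 ≡ᵇ 2 ℕ.* j) ≡ 0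
  noDouble zero = ℕ.*-zeroʳ (f 0)
  noDouble (suc j) = trans (cong (λ a → f a ℕ.* bit (1 ≡ᵇ a)) (ℕ.*-suc 2 j)) (ℕ.*-zeroʳ (f (2 ℕ.+ 2 ℕ.* j)))
sum-at-double (suc J) (suc (suc t)) f t<2J = begin
  sumℕ (λ j → f (2 ℕ.* j) ℕ.* bit (2 ℕ.+ t ≡ᵇ 2 ℕ.* j)) (upTo (suc J))
    ≡⟨ sumℕ-upTo-suc (λ j → f (2 ℕ.* j) ℕ.* bit (2 ℕ.+ t ≡ᵇ 2 ℕ.* j)) J ⟩
  f 0 ℕ.* 0 ℕ.+ sumℕ (λ j → f (2 ℕ.* suc j) ℕ.* bit (2 ℕ.+ t ≡ᵇ 2 ℕ.* suc j)) (upTo J)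
    ≡⟨ cong₂ ℕ._+_ (ℕ.*-zeroʳ (f 0))
         (sumℕ-cong (λ j → cong (λ a → f a ℕ.* bit (2 ℕ.+ t ≡ᵇ a)) (ℕ.*-suc 2 j)) (upTo J)) ⟩
  sumℕ (λ j → f (2 ℕ.+ 2 ℕ.* j) ℕ.* bit (t ≡ᵇ 2 ℕ.* j)) (upTo J)
    ≡⟨ sum-at-double J t (λ a → f (2 ℕ.+ a))
         (ℕ.s<s⁻¹ (ℕ.s<s⁻¹ (subst (2 ℕ.+ t <_) (ℕ.*-suc 2 J) t<2J))) ⟩
  (if odd t then 0 else f (2 ℕ.+ t))
    ≡⟨ cong (λ b → if b then 0 else f (2 ℕ.+ t)) (not-involutive (odd t)) ⟨
  (if not (not (odd t)) then 0 else f (2 ℕ.+ t)) ∎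

evenConvolution-base : ∀ J p t → t < 2 ℕ.* J → evenConvolution J p 0 t ≡ evenBinomial p t
evenConvolution-base J p t t<2J = trans
  (sumℕ-cong (λ j → cong ((p C (2 ℕ.* j)) ℕ.*_) (shiftedBinomial-0ˡ t (2 ℕ.* j))) (upTo J))
  (sum-at-double J t (p C_) t<2J)

evenConvolution-pascal : ∀ J p q t →
  evenConvolution J p (suc q) (suc t) ≡ evenConvolution J p q t ℕ.+ evenConvolution J p q (suc t)
evenConvolution-pascal J p q t = trans
  (sumℕ-cong (λ j → trans
    (cong ((p C (2 ℕ.* j)) ℕ.*_) (shiftedBinomial-pascal q t (2 ℕ.* j)))
    (ℕ.*-distribˡ-+ (p C (2 ℕ.* j)) (shiftedBinomial q t (2 ℕ.* j)) _)) (upTo J))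
  (sumℕ-+ (λ j → (p C (2 ℕ.* j)) ℕ.* shiftedBinomial q t (2 ℕ.* j))
          (λ j → (p C (2 ℕ.* j)) ℕ.* shiftedBinomial q (suc t) (2 ℕ.* j)) (upTo J))

evenConvolution-suc-0 : ∀ J p q → evenConvolution J p (suc q) 0 ≡ evenConvolution J p q 0
evenConvolution-suc-0 J p q =
  sumℕ-cong (λ j → cong ((p C (2 ℕ.* j)) ℕ.*_) (shiftedBinomial-0ᵐ q (2 ℕ.* j))) (upTo J)

-- Induction on the kept coordinates: putting one into S raises w by 1 and leaves o alone, so the
-- count obeys the same Pascal recursion as the convolution. Here m counts the complemented
-- coordinates.
multiplicity-formula : ∀ q m J t → t < 2 ℕ.* J →
  multiplicity (q ℕ.+ m) q t ≡ evenConvolution J (suc m) q t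
multiplicity-formula zero m J t t<2J =
  trans (multiplicity-base m t) (sym (evenConvolution-base J (suc m) t t<2J))
multiplicity-formula (suc q) m J zero t<2J = begin
  multiplicity (suc q ℕ.+ m) (suc q) 0
    ≡⟨ sumℕ-allVertices (q ℕ.+ m) (λ S → bit (halfEigenvalue (suc q) S ≡ᵇ 0)) ⟩
  -- With the first coordinate in S the weight is positive, so this half of the vertices counts 0.
  sumℕ (λ _ → 0) (allVertices (q ℕ.+ m)) ℕ.+ multiplicity (q ℕ.+ m) q 0
    ≡⟨ cong₂ ℕ._+_ (sumℕ-zero (allVertices (q ℕ.+ m))) (multiplicity-formula q m J zero t<2J) ⟩
  evenConvolution J (suc m) q 0
    ≡⟨ evenConvolution-suc-0 J (suc m) q ⟨
  evenConvolution J (suc m) (suc q) 0 ∎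
multiplicity-formula (suc q) m J (suc t) t<2J = begin
  multiplicity (suc q ℕ.+ m) (suc q) (suc t)
    ≡⟨ sumℕ-allVertices (q ℕ.+ m) (λ S → bit (halfEigenvalue (suc q) S ≡ᵇ suc t)) ⟩
  multiplicity (q ℕ.+ m) q t ℕ.+ multiplicity (q ℕ.+ m) q (suc t)
    ≡⟨ cong₂ ℕ._+_ (multiplicity-formula q m J t (ℕ.<-trans (ℕ.n<1+n t) t<2J))
                   (multiplicity-formula q m J (suc t) t<2J) ⟩
  evenConvolution J (suc m) q t ℕ.+ evenConvolution J (suc m) q (suc t)
    ≡⟨ evenConvolution-pascal J (suc m) q t ⟨
  evenConvolution J (suc m) (suc q) (suc t) ∎

evenConvolution-at-0 : ∀ J p q → 0 < 2 ℕ.* J → evenConvolution J p q 0 ≡ 1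
evenConvolution-at-0 J p zero    0<2J = evenConvolution-base J p 0 0<2J
evenConvolution-at-0 J p (suc q) 0<2J = trans (evenConvolution-suc-0 J p q) (evenConvolution-at-0 J p q 0<2J)

-- Accounts for the multiplicity k - 1 of the eigenvalue 2, listed apart from the γ's. At q = 0 the
-- value is 0 because 1 is odd; each kept coordinate adds 1.
evenConvolution-at-1 : ∀ J p q → 1 < 2 ℕ.* J → evenConvolution J p q 1 ≡ q
evenConvolution-at-1 J p zero    1<2J = evenConvolution-base J p 1 1<2J
evenConvolution-at-1 J p (suc q) 1<2J = trans (evenConvolution-pascal J p q 0)
  (cong₂ ℕ._+_ (evenConvolution-at-0 J p q (ℕ.<-trans z<s 1<2J)) (evenConvolution-at-1 J p q 1<2J))

-- A top-degree term: the lower indices a and q + m + 1 - a cannot both be in range.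
binomial-product-vanishes : ∀ q m a → (m C a) ℕ.* shiftedBinomial q (suc (q ℕ.+ m)) a ≡ 0
binomial-product-vanishes q m a with a ℕ.≤? m
... | no a≰m  = cong (ℕ._* shiftedBinomial q (suc (q ℕ.+ m)) a) (k>n⇒nCk≡0 (ℕ.≰⇒> a≰m))
... | yes a≤m = trans (cong ((m C a) ℕ.*_) (vanishes (a ≤ᵇ suc (q ℕ.+ m)))) (ℕ.*-zeroʳ (m C a))
  where
  vanishes : ∀ b → (if b then q C (suc (q ℕ.+ m) ∸ a) else 0) ≡ 0
  vanishes false = refl
  vanishes true  = k>n⇒nCk≡0 (ℕ.m+n≤o⇒m≤o∸n (suc q) (s≤s (ℕ.+-monoʳ-≤ q a≤m)))

-- Finite products grouped by value

product-cong : {I : Set} {g h : I → ℤ} → (∀ i → g i ≡ h i) → ∀ L → product g L ≡ product h L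
product-cong e []      = refl
product-cong e (i ∷ L) = cong₂ _*_ (e i) (product-cong e L)

product-one : {I : Set} (L : List I) → product (λ _ → 1ℤ) L ≡ 1ℤ
product-one []      = refl
product-one (i ∷ L) = trans (*-identityˡ _) (product-one L)

product-* : {I : Set} (g h : I → ℤ) → ∀ L → product (λ i → g i * h i) L ≡ product g L * product h L
product-* g h []      = refl
product-* g h (i ∷ L) rewrite product-* g h L = lemma (g i) (h i) (product g L) (product h L)
  where
  lemma : ∀ a b x y → a * b * (x * y) ≡ a * x * (b * y)
  lemma = solve-∀

product-++ : {I : Set} (g : I → ℤ) (L M : List I) → product g (L ++ M) ≡ product g L * product g M
product-++ g []      M = sym (*-identityˡ _)
product-++ g (i ∷ L) M = trans (cong (g i *_) (product-++ g L M)) (sym (*-assoc (g i) _ _))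

product-map : {I J : Set} (g : J → ℤ) (h : I → J) (L : List I) → product g (map h L) ≡ product (g ∘ h) L
product-map g h []      = refl
product-map g h (i ∷ L) = cong (g (h i) *_) (product-map g h L)

product-upTo-suc : ∀ (g : ℕ → ℤ) B → product g (upTo (suc B)) ≡ g 0 * product (g ∘ suc) (upTo B)
product-upTo-suc g B = cong (g 0 *_)
  (trans (cong (product g) (sym (map-upTo suc B))) (product-map g suc (upTo B)))

product-single : ∀ (g : ℕ → ℤ) e B → e < B → product (λ t → g t ^ bit (e ≡ᵇ t)) (upTo B) ≡ g e
product-single g zero (suc B) _ = begin
  product (λ t → g t ^ bit (0 ≡ᵇ t)) (upTo (suc B)) ≡⟨ product-upTo-suc (λ t → g t ^ bit (0 ≡ᵇ t)) B ⟩
  g 0 ^ 1 * product (λ t → 1ℤ) (upTo B)             ≡⟨ cong₂ _*_ (*-identityʳ (g 0)) (product-one (upTo B)) ⟩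
  g 0 * 1ℤ                                          ≡⟨ *-identityʳ (g 0) ⟩
  g 0                                               ∎
product-single g (suc e) (suc B) (s≤s e<B) = begin
  product (λ t → g t ^ bit (suc e ≡ᵇ t)) (upTo (suc B))
    ≡⟨ product-upTo-suc (λ t → g t ^ bit (suc e ≡ᵇ t)) B ⟩
  1ℤ * product (λ t → g (suc t) ^ bit (e ≡ᵇ t)) (upTo B)
    ≡⟨ *-identityˡ _ ⟩
  product (λ t → g (suc t) ^ bit (e ≡ᵇ t)) (upTo B)
    ≡⟨ product-single (g ∘ suc) e B e<B ⟩
  g (suc e) ∎

-- Each factor is spread over all values t < B, with exponent 1 at its own value and 0 elsewhere; on
-- multiplying, the exponents add up to the multiplicities.
product-by-value : {I : Set} (g : ℕ → ℤ) (e : I → ℕ) (B : ℕ) → (∀ i → e i < B) → ∀ L →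
  product (g ∘ e) L ≡ product (λ t → g t ^ sumℕ (λ i → bit (e i ≡ᵇ t)) L) (upTo B)
product-by-value g e B e<B []      = sym (product-one (upTo B))
product-by-value g e B e<B (i ∷ L) = begin
  g (e i) * product (g ∘ e) L
    ≡⟨ cong₂ _*_ (sym (product-single g (e i) B (e<B i))) (product-by-value g e B e<B L) ⟩
  product (λ t → g t ^ bit (e i ≡ᵇ t)) (upTo B) * product (λ t → g t ^ m t) (upTo B)
    ≡⟨ product-* (λ t → g t ^ bit (e i ≡ᵇ t)) (λ t → g t ^ m t) (upTo B) ⟨
  product (λ t → g t ^ bit (e i ≡ᵇ t) * g t ^ m t) (upTo B)
    ≡⟨ product-cong (λ t → ^-distribˡ-+-* (g t) (bit (e i ≡ᵇ t)) (m t)) (upTo B) ⟨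
  product (λ t → g t ^ (bit (e i ≡ᵇ t) ℕ.+ m t)) (upTo B) ∎
  where
  m = λ t → sumℕ (λ i → bit (e i ≡ᵇ t)) L

weight≤n : ∀ {n} (S : Vertex n) → weight S ≤ n
weight≤n []ᵥ          = z≤n
weight≤n (true ∷ᵥ S)  = s≤s (weight≤n S)
weight≤n (false ∷ᵥ S) = ℕ.m≤n⇒m≤1+n (weight≤n S)

-- From w ≤ n and o ≤ 1: the eigenvalues stay within 0, 2, ..., 2n + 2.
halfEigenvalue<2+n : ∀ {n} q (S : Vertex n) → halfEigenvalue q S < 2 ℕ.+ n
halfEigenvalue<2+n {n} q S = s≤s (subst (halfEigenvalue q S ≤_) (ℕ.+-comm n 1)
  (ℕ.+-mono-≤ (weight≤n S) (bit≤1 (oddAfter q S))))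
  where
  bit≤1 : ∀ b → bit b ≤ 1
  bit≤1 true  = s≤s z≤n
  bit≤1 false = z≤n

eval-charPolyL-grouped : ∀ x q m → let n = q ℕ.+ suc (suc m) in
  eval x (charPolyL n (suc q))
    ≡ product (λ t → (x - + (2 ℕ.* t)) ^ multiplicity n q t) (upTo (2 ℕ.+ n))
eval-charPolyL-grouped x q m = trans (eval-charPolyL x q m)
  (product-by-value (λ t → x - + (2 ℕ.* t)) (halfEigenvalue q) (2 ℕ.+ n) (halfEigenvalue<2+n q) (allVertices n))
  where n = q ℕ.+ suc (suc m)

-- The claimed spectrum

eval-specPoly : ∀ x L → eval x (specPoly L) ≡ product (λ p → (x - + proj₁ p) ^ proj₂ p) L
eval-specPoly x []            = eval-1 x
eval-specPoly x ((μ , m) ∷ L) = trans (eval-* x ((Xₚ +ₚ constₚ (- (+ μ))) ^ₚ m) (specPoly L)) (cong₂ _*_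
  (trans (eval-^ x (Xₚ +ₚ constₚ (- (+ μ))) m) (cong (_^ m) (lemma x (- (+ μ))))) (eval-specPoly x L))
  where
  lemma : ∀ x c → 0ℤ + c + x * (1ℤ + x * 0ℤ) ≡ x + c
  lemma = solve-∀

-- Follows the layout of `claimedSpectrum`: the eigenvalues 0 and 2, the block 2t + 2 with t = i +
-- 1, and 2n + 2 at the end.
split-ends : ∀ n (h : ℕ → ℤ) → 1 ≤ n → product h (upTo (2 ℕ.+ n))
  ≡ h 0 * (h 1 * (product (λ i → h (2 ℕ.+ i)) (upTo (n ∸ 1)) * h (suc n)))
split-ends (suc N) h _ = begin
  product h (upTo (3 ℕ.+ N))
    ≡⟨ product-upTo-suc h (2 ℕ.+ N) ⟩
  h 0 * product (h ∘ suc) (upTo (2 ℕ.+ N))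
    ≡⟨ cong (h 0 *_) (product-upTo-suc (h ∘ suc) (suc N)) ⟩
  h 0 * (h 1 * product (λ i → h (2 ℕ.+ i)) (upTo (suc N)))
    ≡⟨ cong (λ L → h 0 * (h 1 * product (λ i → h (2 ℕ.+ i)) L)) (upTo-∷ʳ N) ⟨
  h 0 * (h 1 * product (λ i → h (2 ℕ.+ i)) (upTo N ++ N ∷ []))
    ≡⟨ cong (λ z → h 0 * (h 1 * z)) (product-++ (λ i → h (2 ℕ.+ i)) (upTo N) (N ∷ [])) ⟩
  h 0 * (h 1 * (product (λ i → h (2 ℕ.+ i)) (upTo N) * (h (2 ℕ.+ N) * 1ℤ)))
    ≡⟨ cong (λ z → h 0 * (h 1 * (product (λ i → h (2 ℕ.+ i)) (upTo N) * z))) (*-identityʳ (h (2 ℕ.+ N))) ⟩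
  h 0 * (h 1 * (product (λ i → h (2 ℕ.+ i)) (upTo N) * h (2 ℕ.+ N))) ∎

tail-length : ∀ q m → q ℕ.+ suc (suc m) ∸ suc q ≡ suc m
tail-length q m = trans (cong (_∸ suc q) (ℕ.+-suc q (suc m))) (ℕ.m+n∸m≡n (suc q) (suc m))

-- The eigenvalue 2t + 2 has half t + 1, whence the shift of index. With k = q + 1 and n = q + m +
-- 2, the upper index n - k + 2 is m + 3.
γ≡evenConvolution : ∀ q m t → let n = q ℕ.+ suc (suc m) in
  γ n (suc q) t ≡ evenConvolution (suc n) (3 ℕ.+ m) q (suc t)
γ≡evenConvolution q m t rewrite tail-length q m | ℕ.+-comm m 2 | ℕ.+-comm t 1 = refl

-- By Pascal's rule C(n-k+2, 2j) = C(n-k+1, 2j-1) + C(n-k+1, 2j), and the last summand vanishes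
-- against C(k-1, n+1-2j) by `binomial-product-vanishes`. So γₙ continues the pattern of the other
-- γ's.
γₙ≡evenConvolution : ∀ q m → let n = q ℕ.+ suc (suc m) in
  γₙ n (suc q) ≡ evenConvolution (suc n) (3 ℕ.+ m) q (suc n)
γₙ≡evenConvolution q m = begin
  γₙ n (suc q)
    ≡⟨ cong₂ (λ p s → sumℕ (λ i → (p C (2 ℕ.* suc i ∸ 1)) ℕ.* shiftedBinomial q s (2 ℕ.* suc i)) (upTo n))
         (trans (cong (ℕ._+ 1) (tail-length q m)) (ℕ.+-comm (suc m) 1)) (ℕ.+-comm n 1) ⟩
  sumℕ (λ i → ((2 ℕ.+ m) C (2 ℕ.* suc i ∸ 1)) ℕ.* shiftedBinomial q (suc n) (2 ℕ.* suc i)) (upTo n)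
    ≡⟨ sumℕ-cong (λ i → step (2 ℕ.* suc i ∸ 1)) (upTo n) ⟩
  sumℕ (λ i → ((3 ℕ.+ m) C (2 ℕ.* suc i)) ℕ.* shiftedBinomial q (suc n) (2 ℕ.* suc i)) (upTo n)
    -- The sum in γₙ starts at j = 1; the missing term j = 0 is C(q, n + 1), which is 0 because q <
    -- n + 1.
    ≡⟨ cong (ℕ._+ sumℕ (λ i → f (suc i)) (upTo n)) (trans (ℕ.*-identityˡ _) (k>n⇒nCk≡0 (s≤s (ℕ.m≤m+n q (2 ℕ.+ m))))) ⟨
  f 0 ℕ.+ sumℕ (λ i → f (suc i)) (upTo n)
    ≡⟨ sumℕ-upTo-suc f n ⟨
  evenConvolution (suc n) (3 ℕ.+ m) q (suc n) ∎
  where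
  n = q ℕ.+ suc (suc m)
  f : ℕ → ℕ
  f j = ((3 ℕ.+ m) C (2 ℕ.* j)) ℕ.* shiftedBinomial q (suc n) (2 ℕ.* j)
  step : ∀ b → ((2 ℕ.+ m) C b) ℕ.* shiftedBinomial q (suc n) (suc b)
    ≡ ((3 ℕ.+ m) C suc b) ℕ.* shiftedBinomial q (suc n) (suc b)
  step b = begin
    ((2 ℕ.+ m) C b) ℕ.* s                             ≡⟨ ℕ.+-identityʳ _ ⟨
    ((2 ℕ.+ m) C b) ℕ.* s ℕ.+ 0
      ≡⟨ cong (((2 ℕ.+ m) C b) ℕ.* s ℕ.+_) (binomial-product-vanishes q (2 ℕ.+ m) (suc b)) ⟨
    ((2 ℕ.+ m) C b) ℕ.* s ℕ.+ ((2 ℕ.+ m) C suc b) ℕ.* s ≡⟨ ℕ.*-distribʳ-+ s ((2 ℕ.+ m) C b) _ ⟨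
    (((2 ℕ.+ m) C b) ℕ.+ ((2 ℕ.+ m) C suc b)) ℕ.* s   ≡⟨ cong (ℕ._* s) (nCk+nC[k+1]≡[n+1]C[k+1] (2 ℕ.+ m) b) ⟩
    ((3 ℕ.+ m) C suc b) ℕ.* s                         ∎
    where s = shiftedBinomial q (suc n) (suc b)

product-upTo-cong : ∀ {g h : ℕ → ℤ} B → (∀ t → t < B → g t ≡ h t) → product g (upTo B) ≡ product h (upTo B)
product-upTo-cong         zero    e = refl
product-upTo-cong {g} {h} (suc B) e = begin
  product g (upTo (suc B))         ≡⟨ product-upTo-suc g B ⟩
  g 0 * product (g ∘ suc) (upTo B) ≡⟨ cong₂ _*_ (e 0 z<s) (product-upTo-cong B (λ t t<B → e (suc t) (s<s t<B))) ⟩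
  h 0 * product (h ∘ suc) (upTo B) ≡⟨ product-upTo-suc h B ⟨
  product h (upTo (suc B))         ∎

-- The sum in γ has n + 1 terms, so J = n + 1 has to exceed half of every t up to n + 1.
below-twice : ∀ n {t} → t < 2 ℕ.+ n → t < 2 ℕ.* suc n
below-twice n t<2+n = ℕ.<-≤-trans t<2+n
  (subst (2 ℕ.+ n ≤_) (sym (ℕ.*-suc 2 n)) (ℕ.+-monoʳ-≤ 2 (ℕ.m≤m+n n (n ℕ.+ 0))))

eval-claimedSpectrum : ∀ x q m → let n = q ℕ.+ suc (suc m) in
  eval x (specPoly (claimedSpectrum n (suc q)))
    ≡ product (λ t → (x - + (2 ℕ.* t)) ^ evenConvolution (suc n) (3 ℕ.+ m) q t) (upTo (2 ℕ.+ n))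
eval-claimedSpectrum x q m = begin
  eval x (specPoly (claimedSpectrum n (suc q)))
    ≡⟨ eval-specPoly x (claimedSpectrum n (suc q)) ⟩
  g (0 , 1) * (g (2 , q) * product g (map middle (upTo (n ∸ 1)) ++ (2 ℕ.* n ℕ.+ 2 , γₙ n (suc q)) ∷ []))
    ≡⟨ cong (λ z → g (0 , 1) * (g (2 , q) * z)) (trans
         (product-++ g (map middle (upTo (n ∸ 1))) _)
         (cong₂ _*_ (product-map g middle (upTo (n ∸ 1))) (*-identityʳ (g (2 ℕ.* n ℕ.+ 2 , γₙ n (suc q)))))) ⟩
  g (0 , 1) * (g (2 , q) * (product (g ∘ middle) (upTo (n ∸ 1)) * g (2 ℕ.* n ℕ.+ 2 , γₙ n (suc q))))
    -- The separately listed multiplicities 1 and k - 1 are recognised as the convolution at 0 and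
    -- at 1.
    ≡⟨ cong₂ (λ a b → a * (b * (product (g ∘ middle) (upTo (n ∸ 1)) * g (2 ℕ.* n ℕ.+ 2 , γₙ n (suc q)))))
         (cong ((x - + 0) ^_) (sym (evenConvolution-at-0 (suc n) (3 ℕ.+ m) q (below-twice n z<s))))
         (cong ((x - + 2) ^_) (sym (evenConvolution-at-1 (suc n) (3 ℕ.+ m) q (below-twice n (s<s z<s))))) ⟩
  h 0 * (h 1 * (product (g ∘ middle) (upTo (n ∸ 1)) * g (2 ℕ.* n ℕ.+ 2 , γₙ n (suc q))))
    ≡⟨ cong₂ (λ a b → h 0 * (h 1 * (a * b)))
         (product-cong (λ i → cong₂ (λ μ c → (x - + μ) ^ c) (shift (suc i)) (γ≡evenConvolution q m (suc i))) (upTo (n ∸ 1)))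
         (cong₂ (λ μ c → (x - + μ) ^ c) (shift n) (γₙ≡evenConvolution q m)) ⟩
  h 0 * (h 1 * (product (λ i → h (2 ℕ.+ i)) (upTo (n ∸ 1)) * h (suc n)))
    ≡⟨ split-ends n h (ℕ.≤-trans (s≤s z≤n) (ℕ.m≤n+m (2 ℕ.+ m) q)) ⟨
  product h (upTo (2 ℕ.+ n)) ∎
  where
  n = q ℕ.+ suc (suc m)
  g : ℕ × ℕ → ℤ
  g p = (x - + proj₁ p) ^ proj₂ p
  middle : ℕ → ℕ × ℕ
  middle i = 2 ℕ.* suc i ℕ.+ 2 , γ n (suc q) (suc i)
  h : ℕ → ℤ
  h t = (x - + (2 ℕ.* t)) ^ evenConvolution (suc n) (3 ℕ.+ m) q t
  shift : ∀ a → 2 ℕ.* a ℕ.+ 2 ≡ 2 ℕ.* suc a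
  shift a = trans (ℕ.+-comm (2 ℕ.* a) 2) (sym (ℕ.*-suc 2 a))

-- Writing k = q + 1 and n = q + m + 2 encodes 1 ≤ k ≤ n - 1 without subtraction and exposes the n -
-- k + 1 = m + 2 complemented coordinates.
charPolyL-spectrum : ∀ q m → let n = q ℕ.+ suc (suc m) in
  charPolyL n (suc q) ≈ₚ specPoly (claimedSpectrum n (suc q))
charPolyL-spectrum q m = eval-≡⇒≈ₚ (charPolyL n (suc q)) (specPoly (claimedSpectrum n (suc q))) λ a → begin
  eval (+ suc a) (charPolyL n (suc q))
    ≡⟨ eval-charPolyL-grouped (+ suc a) q m ⟩
  product (λ t → (+ suc a - + (2 ℕ.* t)) ^ multiplicity n q t) (upTo (2 ℕ.+ n))
    ≡⟨ product-upTo-cong (2 ℕ.+ n) (λ t t<2+n → cong ((+ suc a - + (2 ℕ.* t)) ^_)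
         (multiplicity-formula q (2 ℕ.+ m) (suc n) t (below-twice n t<2+n))) ⟩
  product (λ t → (+ suc a - + (2 ℕ.* t)) ^ evenConvolution (suc n) (3 ℕ.+ m) q t) (upTo (2 ℕ.+ n))
    ≡⟨ eval-claimedSpectrum (+ suc a) q m ⟨
  eval (+ suc a) (specPoly (claimedSpectrum n (suc q))) ∎
  where n = q ℕ.+ suc (suc m)

theorem3 : (n k : ℕ) → 2 ≤ n → 1 ≤ k → k ≤ n ∸ 1 →
    charPolyL n k ≈ₚ specPoly (claimedSpectrum n k)
theorem3 (suc n) (suc q) _ _ k≤n =
  -- The dimension is `suc n` and k is `suc q`, so m is the slack `n ∸ suc q` left by k ≤ n.
  subst (λ n → charPolyL n (suc q) ≈ₚ specPoly (claimedSpectrum n (suc q))) decomposition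
    (charPolyL-spectrum q (n ∸ suc q))
  where
  decomposition : q ℕ.+ suc (suc (n ∸ suc q)) ≡ suc n
  decomposition = trans (ℕ.+-suc q (suc (n ∸ suc q)))
    (cong suc (trans (ℕ.+-suc q (n ∸ suc q)) (ℕ.m+[n∸m]≡n k≤n)))
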